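{- Let $\mathcal M$ be a Hurwitz map, i.e. a regular map of type $\{3,7\}$ on a Hurwitz surface $X$, with orientation-preserving automorphism group $\mathrm{Aut}\,\mathcal M=\langle A,B,C\mid A^2=B^3=C^7=ABC=\dots=1\rangle$ (a quotient of the triangle group $\Gamma[2,3,7]$). Then: (i) no Hurwitz map has link index equal to $1$; (ii) a Hurwitz map has link index $2$ if and only if the underlying Riemann surface is Macbeath's surface of genus $7$; (iii) a Hurwitz map has link index $3$ if and only if the underlying Riemann surface is Klein's surface of genus $3$.
   Context: A Hurwitz surface is a compact Riemann surface of genus $g>1$ with exactly $84(g-1)$ conformal automorphisms; its automorphism group is a quotient of $\Gamma[2,3,7]=\langle A,B,C\mid A^2=B^3=C^7=ABC=1\rangle$ and it carries a regular map of type $\{3,7\}$. Since $3$ and $7$ are odd, every mirror of a reflection of such a map has pattern $(\mathbf{010212})^K$ (vertices $\mathbf 0$, edge-centres $\mathbf 1$, face-centres $\mathbf 2$ met in this order, repeated $K$ times around the mirror); the integer $K$ is the link index of the map, and it equals the order in $\mathrm{Aut}\,\mathcal M$ of the mirror automorphism $S=B^2CB^2C^4BC^4$. Macbeath's surface is the Hurwitz surface of genus $7$ (automorphism group of order $504$); Klein's surface is the Hurwitz surface of genus $3$ (the Klein quartic, automorphism group of order $168$). -}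

module Defs where

open import Data.Nat using (ℕ; zero; suc; _≤_; _<_; _*_; _∸_)
open import Data.Fin using (Fin)
open import Data.Sum using (_⊎_)
open import Data.Product using (_×_)
open import Relation.Binary.PropositionalEquality using (_≡_; _≢_)
open import Algebra.Core using (Op₁; Op₂)
open import Algebra.Structures using (IsGroup)

record FinGroup (n : ℕ) : Set where
  infixl 7 _∙_
  field
    _∙_     : Op₂ (Fin n)
    ε       : Fin n
    _⁻¹     : Op₁ (Fin n)
    isGroup : IsGroup _≡_ _∙_ ε _⁻¹

module _ {n : ℕ} (G : FinGroup n) where
  open FinGroup G

  pow : Fin n → ℕ → Fin n
  pow x zero    = ε
  pow x (suc k) = x ∙ pow x k

  record HasOrder (x : Fin n) (k : ℕ) : Set where
    field
      positive : 1 ≤ k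
      pow≡ε    : pow x k ≡ ε
      minimal  : ∀ j → 1 ≤ j → j < k → pow x j ≢ ε

  data InSubgroup (X : Fin n → Set) : Fin n → Set where
    gen  : ∀ {x} → X x → InSubgroup X x
    unit : InSubgroup X ε
    mul  : ∀ {x y} → InSubgroup X x → InSubgroup X y → InSubgroup X (x ∙ y)
    inv  : ∀ {x} → InSubgroup X x → InSubgroup X (x ⁻¹)

  -- A generating triple (A,B,C) with A²=B³=C⁷=ABC=1, i.e. an epimorphism
  -- Γ[2,3,7] → G (G = Aut M of an orientable regular map of type {3,7}).
  record HurwitzTriple : Set where
    field
      A B C  : Fin n
      A²     : pow A 2 ≡ ε
      B³     : pow B 3 ≡ ε
      C⁷     : pow C 7 ≡ ε
      ABC    : A ∙ B ∙ C ≡ ε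
      generates : ∀ x → InSubgroup (λ y → (y ≡ A ⊎ y ≡ B) ⊎ y ≡ C) x

  mirror : HurwitzTriple → Fin n
  mirror h = pow B 2 ∙ C ∙ pow B 2 ∙ pow C 4 ∙ B ∙ pow C 4
    where open HurwitzTriple h

  LinkIndex : HurwitzTriple → ℕ → Set
  LinkIndex h K = HasOrder (mirror h) K

  -- the underlying (Hurwitz) surface has genus g > 1 : |Aut M| = 84(g-1)
  HasHurwitzGenus : ℕ → Set
  HasHurwitzGenus g = 1 < g × n ≡ 84 * (g ∸ 1)

{-# OPTIONS --safe #-}
module Submission where

-- Since B = AC⁻¹, everything is written in A and C.  Todd–Coxeter enumeration of the cosets of ⟨C⟩, which is
-- sound for every group satisfying the given relators, shows that the mirror automorphism S satisfies S ≠ 1,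
-- that S² = 1 bounds the order n by 7·72 = 504, and that S³ = 1 bounds it by 7·24 = 168.
-- The remaining orders, and the converses, come from a Sylow-type count.  Let N be the normaliser of ⟨C⟩.  The
-- double cosets ⟨C⟩x⟨C⟩ outside N have 49 elements, so |N| ≡ n (mod 49).  If m words satisfy m|N| > n, then two
-- of them lie in the same left coset of N, so some quotient u of the two satisfies uCu⁻¹ = Cᵏ; adding this
-- relation and enumerating cosets again either collapses the group or yields S² = 1 or S³ = 1.
--   n = 84:  |N| ≥ 35, and 8 words give a contradiction.
--   n = 168: |N| ≥ 21, and 9 words give S³ = 1.
--   n = 504: if |N| ≥ 63, then 9 words give S³ = 1, hence n ≤ 168.  Otherwise |N| = 14, so that k = ±1, and
--            37 words give S² = 1 (or again S³ = 1).
-- If S² = 1, the commutator of A and B has order 9, so 9 ∣ n and only n = 252 is left besides 504; there N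
-- contains an element inverting C, hence |N| ≥ 56, and the 8 words apply.

open import Defs
open import Algebra.Bundles using (Group)
import Algebra.Properties.Group as GroupProperties
open import Algebra.Structures using (IsGroup)
open import Data.Bool using (Bool; true; false; if_then_else_; _∧_; _∨_)
open import Data.Bool.ListAction using (all)
open import Data.Bool.Properties using (∧-conicalˡ; ∧-conicalʳ; T-≡)
open import Data.Empty using (⊥; ⊥-elim)
open import Data.Fin using (Fin; zero; suc; toℕ; fromℕ<)
open import Data.Fin.Properties using (_≟_; all?; any?; toℕ-fromℕ<; toℕ-injective; toℕ<n)
open import Data.List using (List; []; _∷_; _++_; _ʳ++_; allFin; cartesianProductWith; concat; concatMap; deduplicate; filter; foldl; length; map; reverse; tabulate; upTo)
open import Data.List.Membership.Propositional using (_∈_; _∉_; find)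
open import Data.List.Membership.Propositional.Properties using (∈-∃++; ∈-++⁺ˡ; ∈-++⁺ʳ; ∈-++⁻; ∈-allFin; ∈-cartesianProductWith⁺; ∈-cartesianProductWith⁻; ∈-deduplicate⁺; ∈-filter⁺; ∈-filter⁻; ∈-map⁺; ∈-map⁻; ∈-tabulate⁺; ∈-tabulate⁻; ∈-upTo⁺)
open import Data.List.Properties using (≡-dec; length-++; length-map; length-tabulate; unfold-reverse; ʳ++-ʳ++)
open import Data.List.Relation.Binary.Disjoint.Propositional using (Disjoint)
open import Data.List.Relation.Binary.Subset.Propositional using (_⊆_)
open import Data.List.Relation.Unary.All as All using (All; []; _∷_)
import Data.List.Relation.Unary.All.Properties as All
open import Data.List.Relation.Unary.AllPairs using (AllPairs; []; _∷_)
open import Data.List.Relation.Unary.Any as Any using (here; there)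
open import Data.List.Relation.Unary.Unique.Propositional using (Unique)
import Data.List.Relation.Unary.Unique.Propositional.Properties as Unique
open import Data.Maybe using (Maybe; just; nothing)
open import Data.Maybe.Properties using (just-injective)
open import Data.Nat using (ℕ; zero; suc; _+_; _*_; _∸_; _≤_; _<_; z≤n; s≤s; _≤?_; _<?_; _≡ᵇ_; NonZero)
open import Data.Nat.Divisibility using (_∣_; _∣?_; _∣0; ∣-refl; ∣m∣n⇒∣m+n; quotient)
open import Data.Nat.DivMod using (_%_; _/_; _mod_; m≡m%n+[m/n]*n; m%n<n)
import Data.Nat.Properties as ℕ
open import Data.Nat.Properties using (≡ᵇ⇒≡; *-cancelʳ-<; *-cancelˡ-≤; *-comm; *-monoʳ-≤; *-monoˡ-≤; +-cancelʳ-≤; +-cancelˡ-<; +-comm; +-monoʳ-≤; +-monoˡ-≤; +-suc; <-cmp; <⇒≤; m+[n∸m]≡n; m>n⇒m∸n≢0; m∸n≤m; m≤m*n; ≤-<-trans; ≤-antisym; ≤-refl; ≤-reflexive; ≤-trans; ≤⇒≯; module ≤-Reasoning)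
open import Data.Product using (_×_; _,_; ∃; ∃₂; proj₁; proj₂; uncurry)
open import Data.Sum using (_⊎_; inj₁; inj₂; [_,_]′)
open import Function.Base using (_∘_)
open import Function.Bundles using (_⇔_; mk⇔; Equivalence)
open import Relation.Binary using (DecidableEquality; IsEquivalence; Rel; tri<; tri≈; tri>)
open import Relation.Binary.PropositionalEquality using (_≡_; _≢_; refl; sym; trans; cong; cong₂; subst; subst₂; module ≡-Reasoning)
open import Relation.Nullary using (¬_; Dec; yes; no; does; contradiction)
open import Relation.Nullary.Decidable using (_⊎-dec_; from-no; from-yes)
open import Relation.Unary using (Decidable)
open import Relation.Unary.Properties using (∁?)

-- Counting in lists

-- By induction, deleting from `ys` the occurrence of the head found by `∈-∃++`; uniqueness keeps
-- the tail inside what remains.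
unique-⊆⇒length≤ : ∀ {A : Set} {xs ys : List A} → Unique xs → xs ⊆ ys → length xs ≤ length ys
unique-⊆⇒length≤ {xs = []} _ _ = z≤n
unique-⊆⇒length≤ {xs = x ∷ xs} u@(_ ∷ xs!) xs⊆ys with ∈-∃++ (xs⊆ys (here refl))
... | as , bs , refl = begin
    suc (length xs)              ≤⟨ s≤s (unique-⊆⇒length≤ xs! xs⊆as++bs) ⟩
    suc (length (as ++ bs))      ≡⟨ cong suc (length-++ as) ⟩
    suc (length as + length bs)  ≡⟨ sym (+-suc (length as) (length bs)) ⟩
    length as + suc (length bs)  ≡⟨ sym (length-++ as) ⟩
    length (as ++ x ∷ bs)        ∎
  where
  open ≤-Reasoning
  xs⊆as++bs : xs ⊆ as ++ bs
  xs⊆as++bs z∈xs with ∈-++⁻ as (xs⊆ys (there z∈xs))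
  ... | inj₁ z∈as          = ∈-++⁺ˡ z∈as
  ... | inj₂ (here refl)   = contradiction z∈xs (Unique.Unique[x∷xs]⇒x∉xs u)
  ... | inj₂ (there z∈bs)  = ∈-++⁺ʳ as z∈bs

length-filter-∁ : ∀ {A : Set} {P : A → Set} (P? : Decidable P) (xs : List A) →
  length (filter P? xs) + length (filter (∁? P?) xs) ≡ length xs
length-filter-∁ P? [] = refl
length-filter-∁ P? (x ∷ xs) with P? x
... | yes _ = cong suc (length-filter-∁ P? xs)
... | no  _ = trans (+-suc _ _) (cong suc (length-filter-∁ P? xs))

module _ {A : Set} (_≟_ : DecidableEquality A) (m : ℕ) (block : A → List A) where
  open import Data.List.Membership.DecPropositional _≟_ using (_∈?_)

  -- The blocks are the classes of an equivalence, kept abstract because two partitions are counted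
  -- later: cosets of a cyclic subgroup and double cosets of ⟨C⟩.
  record Blocks (xs : List A) : Set where
    field
      size   : ∀ {x} → x ∈ xs → length (block x) ≡ m
      unique : ∀ {x} → x ∈ xs → Unique (block x)
      self   : ∀ {x} → x ∈ xs → x ∈ block x
      inside : ∀ {x} → x ∈ xs → block x ⊆ xs
      meet   : ∀ {x y z} → x ∈ xs → z ∈ xs → y ∈ block x → y ∈ block z → z ∈ block x

  -- The block of the head accounts for exactly `m` elements; once it is filtered out, the rest is
  -- again a union of blocks. The recursion is on a length bound, `rest` not being a structural
  -- subterm.
  blocks⇒∣length : ∀ xs → Unique xs → Blocks xs → m ∣ length xs
  blocks⇒∣length xs = go (length xs) xs ≤-refl
    where
    go : ∀ b xs → length xs ≤ b → Unique xs → Blocks xs → m ∣ length xs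
    go _ [] _ _ _ = m ∣0
    go (suc b) xs@(x ∷ _) |xs|≤b xs! bl =
      subst (m ∣_) (length-filter-∁ (_∈? block x) xs) (∣m∣n⇒∣m+n (subst (m ∣_) (sym first) ∣-refl)
        (go b rest (fewer |xs|≤b) (Unique.filter⁺ (∁? (_∈? block x)) xs!) restBlocks))
      where
      module B = Blocks bl
      rest = filter (∁? (_∈? block x)) xs
      x∈ : x ∈ xs
      x∈ = here refl
      first : length (filter (_∈? block x) xs) ≡ m
      first = trans
        (≤-antisym
          (unique-⊆⇒length≤ (Unique.filter⁺ (_∈? block x) xs!) λ y∈ → proj₂ (∈-filter⁻ (_∈? block x) {xs = xs} y∈))
          (unique-⊆⇒length≤ (B.unique x∈) λ y∈ → ∈-filter⁺ (_∈? block x) (B.inside x∈ y∈) y∈))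
        (B.size x∈)
      fewer : length xs ≤ suc b → length rest ≤ b
      fewer (s≤s le) = ≤-trans (unique-⊆⇒length≤ (Unique.filter⁺ (∁? (_∈? block x)) xs!) λ y∈ → drop-x (∈-filter⁻ (∁? (_∈? block x)) {xs = xs} y∈)) le
        where
        drop-x : ∀ {y} → y ∈ xs × y ∉ block x → y ∈ _
        drop-x (here refl , y∉) = contradiction (B.self x∈) y∉
        drop-x (there y∈  , _)  = y∈
      from : ∀ {y} → y ∈ rest → y ∈ xs
      from y∈ = proj₁ (∈-filter⁻ (∁? (_∈? block x)) {xs = xs} y∈)
      restBlocks : Blocks rest
      restBlocks = record
        { size   = λ y∈ → B.size (from y∈)
        ; unique = λ y∈ → B.unique (from y∈)
        ; self   = λ y∈ → B.self (from y∈)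
        -- A point of `block y` lying in `block x` would put `y` into `block x` by `meet`.
        ; inside = λ y∈ z∈ → ∈-filter⁺ (∁? (_∈? block x)) (B.inside (from y∈) z∈)
                     λ z∈x → proj₂ (∈-filter⁻ (∁? (_∈? block x)) {xs = xs} y∈) (B.meet x∈ (from y∈) z∈x z∈)
        ; meet   = λ y∈ z∈ → B.meet (from y∈) (from z∈)
        }

-- Todd–Coxeter enumeration of the cosets of ⟨C⟩

-- c̄ stands for C⁻¹.
data Letter : Set where
  a c c̄ : Letter

opp : Letter → Letter
opp a = a
opp c = c̄
opp c̄ = c

_≟ˡ_ : DecidableEquality Letter
a ≟ˡ a = yes refl
a ≟ˡ c = no λ()
a ≟ˡ c̄ = no λ()
c ≟ˡ a = no λ()
c ≟ˡ c = yes refl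
c ≟ˡ c̄ = no λ()
c̄ ≟ˡ a = no λ()
c̄ ≟ˡ c = no λ()
c̄ ≟ˡ c̄ = yes refl

Word : Set
Word = List Letter

_≟ʷ_ : DecidableEquality Word
_≟ʷ_ = ≡-dec _≟ˡ_

invert : Word → Word
invert w = reverse (map opp w)

-- A trie of assertions between cosets, each named by a word with its last letter first: an entry v at key k
-- says that k and v name the same coset.  An entry at g ∷ k thus records the image of the coset k under g, and
-- a coset k is live when its entry is k itself.
data Table : Set where
  ∅    : Table
  node : Maybe Word → Table → Table → Table → Table

entry : Table → Maybe Word
entry ∅              = nothing
entry (node v _ _ _) = v

child : Letter → Table → Table
child _ ∅              = ∅
child a (node _ t _ _) = t
child c (node _ _ t _) = t
child c̄ (node _ _ _ t) = t

putEntry : Word → Table → Table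
putEntry v ∅              = node (just v) ∅ ∅ ∅
putEntry v (node _ l m r) = node (just v) l m r

putChild : Letter → Table → Table → Table
putChild a s ∅              = node nothing s ∅ ∅
putChild c s ∅              = node nothing ∅ s ∅
putChild c̄ s ∅              = node nothing ∅ ∅ s
putChild a s (node v l m r) = node v s m r
putChild c s (node v l m r) = node v l s r
putChild c̄ s (node v l m r) = node v l m s

lookup : Table → Word → Maybe Word
lookup t []      = entry t
lookup t (g ∷ k) = lookup (child g t) k

set : Word → Word → Table → Table
set []      v t = putEntry v t
set (g ∷ k) v t = putChild g (set k v (child g t)) t

lookup-∅ : ∀ k → lookup ∅ k ≡ nothing
lookup-∅ []      = refl
lookup-∅ (_ ∷ k) = lookup-∅ k

entry-putChild : ∀ g s t → entry (putChild g s t) ≡ entry t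
entry-putChild a s ∅              = refl
entry-putChild c s ∅              = refl
entry-putChild c̄ s ∅              = refl
entry-putChild a s (node _ _ _ _) = refl
entry-putChild c s (node _ _ _ _) = refl
entry-putChild c̄ s (node _ _ _ _) = refl

entry-putEntry : ∀ v t → entry (putEntry v t) ≡ just v
entry-putEntry v ∅              = refl
entry-putEntry v (node _ _ _ _) = refl

child-putEntry : ∀ g v t → child g (putEntry v t) ≡ child g t
child-putEntry a v ∅              = refl
child-putEntry c v ∅              = refl
child-putEntry c̄ v ∅              = refl
child-putEntry a v (node _ _ _ _) = refl
child-putEntry c v (node _ _ _ _) = refl
child-putEntry c̄ v (node _ _ _ _) = refl

child-putChild : ∀ g h s t → (g ≡ h × child h (putChild g s t) ≡ s) ⊎ child h (putChild g s t) ≡ child h t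
child-putChild a a s ∅              = inj₁ (refl , refl)
child-putChild a a s (node _ _ _ _) = inj₁ (refl , refl)
child-putChild a c s ∅              = inj₂ refl
child-putChild a c s (node _ _ _ _) = inj₂ refl
child-putChild a c̄ s ∅              = inj₂ refl
child-putChild a c̄ s (node _ _ _ _) = inj₂ refl
child-putChild c a s ∅              = inj₂ refl
child-putChild c a s (node _ _ _ _) = inj₂ refl
child-putChild c c s ∅              = inj₁ (refl , refl)
child-putChild c c s (node _ _ _ _) = inj₁ (refl , refl)
child-putChild c c̄ s ∅              = inj₂ refl
child-putChild c c̄ s (node _ _ _ _) = inj₂ refl
child-putChild c̄ a s ∅              = inj₂ refl
child-putChild c̄ a s (node _ _ _ _) = inj₂ refl
child-putChild c̄ c s ∅              = inj₂ refl
child-putChild c̄ c s (node _ _ _ _) = inj₂ refl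
child-putChild c̄ c̄ s ∅              = inj₁ (refl , refl)
child-putChild c̄ c̄ s (node _ _ _ _) = inj₁ (refl , refl)

-- The disjunction lets an invariant of all entries be checked by cases without deciding whether `k`
-- and `k′` agree.
lookup-set : ∀ k v t k′ → (k ≡ k′ × lookup (set k v t) k′ ≡ just v) ⊎ lookup (set k v t) k′ ≡ lookup t k′
lookup-set []      v t []       = inj₁ (refl , entry-putEntry v t)
lookup-set []      v t (h ∷ k′) = inj₂ (cong (λ s → lookup s k′) (child-putEntry h v t))
lookup-set (g ∷ k) v t []       = inj₂ (entry-putChild g _ t)
lookup-set (g ∷ k) v t (h ∷ k′) with child-putChild g h (set k v (child g t)) t
... | inj₂ eq = inj₂ (cong (λ s → lookup s k′) eq)
... | inj₁ (refl , eq) with lookup-set k v (child g t) k′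
...   | inj₁ (refl , eq′) = inj₁ (refl , trans (cong (λ s → lookup s k′) eq) eq′)
...   | inj₂ eq′          = inj₂ (trans (cong (λ s → lookup s k′) eq) eq′)

-- The numerical arguments here and below are fuel; running out of it only weakens the resulting table.
root : ℕ → Table → Word → Word
root zero    t k = k
root (suc n) t k with lookup t k
... | nothing = k
... | just v  = if does (v ≟ʷ k) then k else root n t v

shorter : Word → Word → Bool
shorter []      _       = true
shorter (_ ∷ _) []      = false
shorter (_ ∷ u) (_ ∷ v) = shorter u v

Pending : Set
Pending = List (Word × Word)

link : Word → Letter → Word → Table → Table
link f g b t = set (opp g ∷ b) f (set (g ∷ f) b t)

-- A different image already present reveals a coincidence of two cosets, which is queued while the
-- old entry stays.
redirect : Word → Letter → Word → Table × Pending → Table × Pending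
redirect f g v (t , q) with lookup t (g ∷ f)
... | nothing = set (g ∷ f) v t , q
... | just e  = if does (root 50 t e ≟ʷ v) then (set (g ∷ f) v t , q) else (t , (e , v) ∷ q)

transfer : Word → Word → Letter → Table × Pending → Table × Pending
transfer hi lo x (t , q) with lookup t (x ∷ hi)
... | nothing = t , q
... | just d  = redirect lo x (root 50 t d) (redirect (root 50 t d) (opp x) lo (t , q))

-- The dead coset `hi` is pointed at `lo` before its neighbours are handed over, so that an entry
-- leading back to `hi` already has root `lo` and is overwritten rather than queued.
absorb : Word → Word → Table → Pending → Table × Pending
absorb hi lo t q = transfer hi lo a (transfer hi lo c (transfer hi lo c̄ (set hi lo t , q)))

merge : ℕ → Table × Pending → Table
unite : ℕ → Word → Word → Table → Pending → Table

merge zero    (t , _)           = t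
merge (suc n) (t , [])          = t
merge (suc n) (t , (u , v) ∷ q) = unite n (root 50 t u) (root 50 t v) t q

unite n u v t q =
  if does (u ≟ʷ v) then merge n (t , q)
  -- The shorter name survives. In particular `[]`, the coset ⟨C⟩ itself, is never absorbed, and a
  -- collapse can be recognised by it.
  else if shorter u v then merge n (absorb v u t q) else merge n (absorb u v t q)

trace : Table → Word → Word → Word × Word
trace t f []      = f , []
trace t f (g ∷ w) with lookup t (g ∷ f)
... | nothing = f , g ∷ w
... | just v  = trace t v w

Queue : Set
Queue = List Word

-- The gap left after scanning a relator from both ends: an empty gap is a coincidence, a single
-- letter a deduction, and a longer gap calls for new cosets. Each new coset is named by the word
-- reaching it, so that linking it makes it live.
fill : Word → Word → Word → Table × Queue → Table × Queue
fill f []              b (t , q) = merge 1000 (t , (f , b) ∷ []) , q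
fill f (g ∷ [])        b (t , q) = link f g b t , q
fill f (g ∷ w@(_ ∷ _)) b (t , q) = fill (g ∷ f) w b (link f g (g ∷ f) t , (g ∷ f) ∷ q)

scan : Word → Word → Table × Queue → Table × Queue
scan k r (t , q) with trace t k r
... | f , s with trace t k (invert s)
...   | b , s′ = fill f (invert s′) b (t , q)

live : Table → Word → Bool
live t k with lookup t k
... | nothing = false
... | just v  = does (v ≟ʷ k)

scans : Word → List Word → Table × Queue → Table × Queue
scans k []       s       = s
scans k (r ∷ rs) (t , q) = if live t k then scans k rs (scan k r (t , q)) else (t , q)

-- The table shows A ∈ ⟨C⟩, which is impossible in a nontrivial group; contradictions are always
-- detected in this form.
collapsed : Table → Bool
collapsed t with lookup t (a ∷ [])
... | just []      = true
... | just (_ ∷ _) = false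
... | nothing      = false

enumerate : ℕ → List Word → Table → Queue → Queue → Table
resume : ℕ → List Word → Queue → Table × Queue → Table

enumerate zero    rs t _        _         = t
enumerate (suc n) rs t []       []        = t
enumerate (suc n) rs t []       q@(_ ∷ _) = enumerate n rs t (reverse q) []
enumerate (suc n) rs t (k ∷ ks) q         = if collapsed t then t else resume n rs ks (scans k rs (t , q))

resume n rs ks (t , q) = enumerate n rs t ks q

-- The third relator is B³; the relation ABC = 1 is built into the substitution B = AC⁻¹.
triangleRelators : List Word
triangleRelators =
  (a ∷ a ∷ []) ∷ (c ∷ c ∷ c ∷ c ∷ c ∷ c ∷ c ∷ []) ∷ (a ∷ c̄ ∷ a ∷ c̄ ∷ a ∷ c̄ ∷ []) ∷ []

-- Opaque, so that tables are evaluated only in the checks that unfold them.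
opaque
  cosetTable : List Word → Table
  cosetTable rs = enumerate 3000 (triangleRelators ++ rs) (link [] c [] (set [] [] ∅)) ([] ∷ []) []

loop : Table → Word → Word → Bool
loop t k w with trace t k w
... | f , []    = does (f ≟ʷ k)
... | _ , _ ∷ _ = false

-- An element fixing the cosets of 1 and A lies in ⟨C⟩ ∩ A⁻¹⟨C⟩A.
fixes : Word → Table → Bool
fixes w t = loop t [] w ∧ loop t (a ∷ []) w

liveEntries : Table → Table → List Word
liveEntries _ ∅ = []
liveEntries t (node v l m r) = own v ++ liveEntries t l ++ liveEntries t m ++ liveEntries t r
  where
  own : Maybe Word → List Word
  own nothing  = []
  own (just v) = if live t v then v ∷ [] else []

cosets : Table → List Word
cosets t = deduplicate _≟ʷ_ (liveEntries t t)

open import Data.List.Membership.DecPropositional _≟ʷ_ using (_∈?_)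

steps-into : Table → List Word → Word → Letter → Bool
steps-into t ks k g with lookup t (g ∷ k)
... | nothing = false
... | just v  = does (v ∈? ks)

-- A certificate read off the finished table: if ⟨C⟩ is listed and the list is stable under all
-- letters, then every word leads to a listed coset, however the enumeration proceeded.
closed : Table → List Word → Bool
closed t ks = does ([] ∈? ks) ∧ all (λ k → all (steps-into t ks k) (a ∷ c ∷ c̄ ∷ [])) ks

closedOfLength : ℕ → Table → List Word → Bool
closedOfLength m t ks = closed t ks ∧ (length ks ≡ᵇ m)

hasCosets : ℕ → Table → Bool
hasCosets m t = closedOfLength m t (cosets t)

all-true : ∀ {A : Set} (p : A → Bool) {xs x} → all p xs ≡ true → x ∈ xs → p x ≡ true
all-true p eq (here refl) = ∧-conicalˡ _ _ eq
all-true p eq (there x∈)  = all-true p (∧-conicalʳ (p _) _ eq) x∈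

-- Soundness of the enumeration

module Soundness
  {ℓ} (_≈_ : Rel Word ℓ) (isEquivalence : IsEquivalence _≈_)
  (extend : ∀ g {k v} → k ≈ v → (g ∷ k) ≈ (g ∷ v))
  (cancel : ∀ g k → (opp g ∷ g ∷ k) ≈ k)
  where

  open IsEquivalence isEquivalence renaming (refl to ≈-refl; sym to ≈-sym; trans to ≈-trans; reflexive to ≈-reflexive)

  -- The invariant of the whole enumeration. Each table operation preserves it whatever the strategy
  -- or the fuel, so a table may be incomplete but never asserts a false coincidence.
  Valid : Table → Set ℓ
  Valid t = ∀ k {v} → lookup t k ≡ just v → k ≈ v

  Relator : Word → Set ℓ
  Relator r = ∀ k → (r ʳ++ k) ≈ k

  extends : ∀ w {k v} → k ≈ v → (w ʳ++ k) ≈ (w ʳ++ v)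
  extends []      k≈v = k≈v
  extends (g ∷ w) k≈v = extends w (extend g k≈v)

  cancels : ∀ w k → (invert w ʳ++ (w ʳ++ k)) ≈ k
  cancels w k = ≈-trans (≈-reflexive (ʳ++-ʳ++ (map opp w))) (go w k)
    where
    go : ∀ w k → (map opp w ++ (w ʳ++ k)) ≈ k
    go []      k = ≈-refl
    go (g ∷ w) k = ≈-trans (extend (opp g) (go w (g ∷ k))) (cancel g k)

  valid-∅ : Valid ∅
  valid-∅ k eq with trans (sym eq) (lookup-∅ k)
  ... | ()

  valid-set : ∀ k v t → k ≈ v → Valid t → Valid (set k v t)
  valid-set k v t k≈v valid k′ eq with lookup-set k v t k′
  ... | inj₁ (refl , eq′) = ≈-trans k≈v (≈-reflexive (just-injective (trans (sym eq′) eq)))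
  ... | inj₂ eq′          = valid k′ (trans (sym eq′) eq)

  root-≈ : ∀ n t k → Valid t → k ≈ root n t k
  root-≈ zero    t k valid = ≈-refl
  root-≈ (suc n) t k valid with lookup t k in eq
  ... | nothing = ≈-refl
  ... | just v with does (v ≟ʷ k)
  ...   | true  = ≈-refl
  ...   | false = ≈-trans (valid _ eq) (root-≈ n t v valid)

  valid-link : ∀ f g b t → (g ∷ f) ≈ b → Valid t → Valid (link f g b t)
  valid-link f g b t gf≈b valid =
    valid-set (opp g ∷ b) f _ (≈-trans (extend (opp g) (≈-sym gf≈b)) (cancel g f)) (valid-set (g ∷ f) b t gf≈b valid)

  ValidPending : Table × Pending → Set ℓ
  ValidPending (t , q) = Valid t × All (uncurry _≈_) q

  valid-redirect : ∀ f g v s → (g ∷ f) ≈ v → ValidPending s → ValidPending (redirect f g v s)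
  valid-redirect f g v (t , q) gf≈v (valid , pend) with lookup t (g ∷ f) in eq
  ... | nothing = valid-set (g ∷ f) v t gf≈v valid , pend
  ... | just e with does (root 50 t e ≟ʷ v)
  ...   | true  = valid-set (g ∷ f) v t gf≈v valid , pend
  ...   | false = valid , ≈-trans (≈-sym (valid _ eq)) gf≈v ∷ pend

  valid-transfer : ∀ hi lo x s → hi ≈ lo → ValidPending s → ValidPending (transfer hi lo x s)
  valid-transfer hi lo x (t , q) hi≈lo (valid , pend) with lookup t (x ∷ hi) in eq
  ... | nothing = valid , pend
  ... | just d  = valid-redirect lo x v _ xlo≈v (valid-redirect v (opp x) lo (t , q) back (valid , pend))
    where
    v = root 50 t d
    xlo≈v : (x ∷ lo) ≈ v
    xlo≈v = ≈-trans (extend x (≈-sym hi≈lo)) (≈-trans (valid _ eq) (root-≈ 50 t d valid))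
    back : (opp x ∷ v) ≈ lo
    back = ≈-trans (extend (opp x) (≈-sym xlo≈v)) (cancel x lo)

  valid-absorb : ∀ hi lo t q → hi ≈ lo → ValidPending (t , q) → ValidPending (absorb hi lo t q)
  valid-absorb hi lo t q hi≈lo (valid , pend) =
    valid-transfer hi lo a _ hi≈lo (valid-transfer hi lo c _ hi≈lo (valid-transfer hi lo c̄ _ hi≈lo
      (valid-set hi lo t hi≈lo valid , pend)))

  valid-merge : ∀ n s → ValidPending s → Valid (merge n s)
  valid-unite : ∀ n u v t q → u ≈ v → ValidPending (t , q) → Valid (unite n u v t q)

  valid-merge zero    (t , _)           (valid , _) = valid
  valid-merge (suc n) (t , [])          (valid , _) = valid
  valid-merge (suc n) (t , (u , v) ∷ q) (valid , u≈v ∷ pend) =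
    valid-unite n _ _ t q (≈-trans (≈-sym (root-≈ 50 t u valid)) (≈-trans u≈v (root-≈ 50 t v valid))) (valid , pend)

  valid-unite n u v t q u≈v s with does (u ≟ʷ v)
  ... | true = valid-merge n (t , q) s
  ... | false with shorter u v
  ...   | true  = valid-merge n _ (valid-absorb v u t q (≈-sym u≈v) s)
  ...   | false = valid-merge n _ (valid-absorb u v t q u≈v s)

  trace-≈ : ∀ t f w → Valid t → let (b , s) = trace t f w in (w ʳ++ f) ≈ (s ʳ++ b)
  trace-≈ t f []      valid = ≈-refl
  trace-≈ t f (g ∷ w) valid with lookup t (g ∷ f) in eq
  ... | nothing = ≈-refl
  ... | just v  = ≈-trans (extends w (valid _ eq)) (trace-≈ t v w valid)

  valid-fill : ∀ f w b t q → (w ʳ++ f) ≈ b → Valid t → Valid (proj₁ (fill f w b (t , q)))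
  valid-fill f []              b t q f≈b  valid = valid-merge 1000 _ (valid , f≈b ∷ [])
  valid-fill f (g ∷ [])        b t q gf≈b valid = valid-link f g b t gf≈b valid
  valid-fill f (g ∷ w@(_ ∷ _)) b t q wf≈b valid =
    valid-fill (g ∷ f) w b _ _ wf≈b (valid-link f g (g ∷ f) t ≈-refl valid)

  -- From kr = k the unread part s of r satisfies fs = k. Hence f = ks⁻¹ = bs′, where s′ is the
  -- unread part of s⁻¹, and the gap s′⁻¹ leads from f to b.
  valid-scan : ∀ k r t q → Relator r → Valid t → Valid (proj₁ (scan k r (t , q)))
  valid-scan k r t q rel valid with trace t k r | trace-≈ t k r valid
  ... | f , s | kr≈ with trace t k (invert s) | trace-≈ t k (invert s) valid
  ...   | b , s′ | back = valid-fill f (invert s′) b t q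
            (≈-trans (extends (invert s′) f≈) (cancels s′ b)) valid
    where
    f≈ : f ≈ (s′ ʳ++ b)
    f≈ = ≈-trans (≈-sym (cancels s f))
           (≈-trans (extends (invert s) (≈-trans (≈-sym kr≈) (rel k))) back)

  valid-scans : ∀ k rs t q → All Relator rs → Valid t → Valid (proj₁ (scans k rs (t , q)))
  valid-scans k []       t q _            valid = valid
  valid-scans k (r ∷ rs) t q (rel ∷ rels) valid with live t k
  ... | true  = valid-scans k rs _ _ rels (valid-scan k r t q rel valid)
  ... | false = valid

  valid-enumerate : ∀ n rs t ks q → All Relator rs → Valid t → Valid (enumerate n rs t ks q)
  valid-enumerate zero    rs t _        _       rels valid = valid
  valid-enumerate (suc n) rs t []       []      rels valid = valid
  valid-enumerate (suc n) rs t []       (_ ∷ _) rels valid = valid-enumerate n rs t _ [] rels valid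
  valid-enumerate (suc n) rs t (k ∷ ks) q       rels valid with collapsed t
  ... | true  = valid
  ... | false = valid-enumerate n rs _ ks _ rels (valid-scans k rs t q rels valid)

  opaque
    unfolding cosetTable
    -- The hypothesis on `c` justifies the initial table, in which the coset ⟨C⟩ is fixed by C.
    valid-cosetTable : ∀ rs → (c ∷ []) ≈ [] → All Relator triangleRelators → All Relator rs → Valid (cosetTable rs)
    valid-cosetTable rs c≈ tri rels =
      valid-enumerate 3000 (triangleRelators ++ rs) _ ([] ∷ []) [] (All.++⁺ tri rels)
        (valid-link [] c [] _ c≈ (valid-set [] [] ∅ ≈-refl valid-∅))

  collapsed-≈ : ∀ t → Valid t → collapsed t ≡ true → (a ∷ []) ≈ []
  collapsed-≈ t valid eq with lookup t (a ∷ []) in found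
  ... | just [] = valid _ found

  loop-≈ : ∀ t k w → Valid t → loop t k w ≡ true → (w ʳ++ k) ≈ k
  loop-≈ t k w valid eq with trace t k w | trace-≈ t k w valid
  ... | f , [] | kw≈f with f ≟ʷ k
  ...   | yes refl = kw≈f

  closed-≈ : ∀ t ks → Valid t → closed t ks ≡ true → ∀ w → ∃ λ k → k ∈ ks × w ≈ k
  closed-≈ t ks valid eq [] with [] ∈? ks
  ... | yes []∈ = [] , []∈ , ≈-refl
  closed-≈ t ks valid eq (g ∷ w) with closed-≈ t ks valid eq w
  ... | k , k∈ , w≈k = after (all-true (steps-into t ks k) (all-true (λ k → all (steps-into t ks k) letters) (∧-conicalʳ (does ([] ∈? ks)) _ eq) k∈) (complete g))
    where
    letters = a ∷ c ∷ c̄ ∷ []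
    complete : ∀ g → g ∈ letters
    complete a = here refl
    complete c = there (here refl)
    complete c̄ = there (there (here refl))
    after : steps-into t ks k g ≡ true → ∃ λ k → k ∈ ks × (g ∷ w) ≈ k
    after eq with lookup t (g ∷ k) in found
    ... | just v with v ∈? ks
    ...   | yes v∈ = v , v∈ , ≈-trans (extend g w≈k) (valid _ found)

-- Powers in finite groups

-- Every nonzero residue d has a multiple congruent to r, so that xᵐ = 1 and xᵈ = 1 force xʳ = 1.
Reaches : (m r : ℕ) .{{_ : NonZero m}} → Set
Reaches m r = ∀ (d : Fin m) → toℕ d ≡ 0 ⊎ ∃ λ (e : Fin m) → (toℕ e * toℕ d) % m ≡ r

reaches? : ∀ m r .{{_ : NonZero m}} → Dec (Reaches m r)
reaches? m r = all? λ d → (toℕ d ℕ.≟ 0) ⊎-dec any? λ e → (toℕ e * toℕ d) % m ℕ.≟ r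

module FinGroupProperties {n : ℕ} (G : FinGroup n) where
  open FinGroup G public
  open IsGroup isGroup public using (assoc; identityˡ; identityʳ; inverseˡ; inverseʳ)

  group : Group _ _
  group = record { isGroup = isGroup }

  open GroupProperties group public
    using (∙-cancelˡ; ∙-cancelʳ; ⁻¹-anti-homo-∙; ⁻¹-involutive; inverseˡ-unique; inverseʳ-unique; ε⁻¹≈ε)
  open ≡-Reasoning

  infixr 8 _^_
  _^_ : Fin n → ℕ → Fin n
  _^_ = pow G

  inverse-cancelˡ : ∀ x y → x ⁻¹ ∙ (x ∙ y) ≡ y
  inverse-cancelˡ x y = trans (sym (assoc _ _ _)) (trans (cong (_∙ y) (inverseˡ x)) (identityˡ y))

  inverse-cancelʳ : ∀ x y → x ∙ y ∙ y ⁻¹ ≡ x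
  inverse-cancelʳ x y = trans (assoc _ _ _) (trans (cong (x ∙_) (inverseʳ y)) (identityʳ x))

  ^-+ : ∀ x i j → x ^ (i + j) ≡ x ^ i ∙ x ^ j
  ^-+ x zero    j = sym (identityˡ _)
  ^-+ x (suc i) j = trans (cong (x ∙_) (^-+ x i j)) (sym (assoc _ _ _))

  ^-* : ∀ x i j → x ^ (i * j) ≡ (x ^ j) ^ i
  ^-* x zero    j = refl
  ^-* x (suc i) j = trans (^-+ x j (i * j)) (cong (x ^ j ∙_) (^-* x i j))

  ε^ : ∀ i → ε ^ i ≡ ε
  ε^ zero    = refl
  ε^ (suc i) = trans (identityˡ _) (ε^ i)

  ^-1 : ∀ x → x ^ 1 ≡ x
  ^-1 = identityʳ

  ^-comm : ∀ x i j → x ^ i ∙ x ^ j ≡ x ^ j ∙ x ^ i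
  ^-comm x i j = trans (sym (^-+ x i j)) (trans (cong (x ^_) (+-comm i j)) (^-+ x j i))

  ^-multiple : ∀ {x m} k → x ^ m ≡ ε → x ^ (k * m) ≡ ε
  ^-multiple {x} {m} k xᵐ = trans (^-* x k m) (trans (cong (_^ k) xᵐ) (ε^ k))

  ^-% : ∀ {x} m .{{_ : NonZero m}} → x ^ m ≡ ε → ∀ k → x ^ k ≡ x ^ (k % m)
  ^-% {x} m xᵐ k = begin
    x ^ k                            ≡⟨ cong (x ^_) (m≡m%n+[m/n]*n k m) ⟩
    x ^ (k % m + k / m * m)          ≡⟨ ^-+ x (k % m) (k / m * m) ⟩
    x ^ (k % m) ∙ x ^ (k / m * m)    ≡⟨ cong (x ^ (k % m) ∙_) (^-multiple (k / m) xᵐ) ⟩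
    x ^ (k % m) ∙ ε                  ≡⟨ identityʳ _ ⟩
    x ^ (k % m)                      ∎

  ^-mod : ∀ {x} m .{{_ : NonZero m}} → x ^ m ≡ ε → ∀ k → x ^ k ≡ x ^ toℕ (k mod m)
  ^-mod {x} m xᵐ k = trans (^-% m xᵐ k) (cong (x ^_) (sym (toℕ-fromℕ< (m%n<n k m))))

  module _ {x : Fin n} {m r : ℕ} .{{_ : NonZero m}} (xᵐ : x ^ m ≡ ε) (xʳ≢ε : x ^ r ≢ ε) (reach : Reaches m r) where

    ^≡ε⇒≡0 : ∀ d → d < m → x ^ d ≡ ε → d ≡ 0
    ^≡ε⇒≡0 d d<m xᵈ with reach (fromℕ< d<m)
    ... | inj₁ d≡0      = trans (sym (toℕ-fromℕ< d<m)) d≡0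
    ... | inj₂ (e , eq) = contradiction (begin
      x ^ r                                       ≡⟨ cong (x ^_) (sym eq) ⟩
      x ^ ((toℕ e * toℕ (fromℕ< d<m)) % m)        ≡⟨ sym (^-% m xᵐ _) ⟩
      x ^ (toℕ e * toℕ (fromℕ< d<m))              ≡⟨ cong (λ d → x ^ (toℕ e * d)) (toℕ-fromℕ< d<m) ⟩
      x ^ (toℕ e * d)                             ≡⟨ ^-multiple (toℕ e) xᵈ ⟩
      ε                                           ∎) xʳ≢ε

    private
      not-< : ∀ {i j} → i < j → j < m → x ^ i ≢ x ^ j
      not-< {i} {j} i<j j<m eq = m>n⇒m∸n≢0 i<j (^≡ε⇒≡0 (j ∸ i) (≤-<-trans (m∸n≤m j i) j<m)
        (∙-cancelˡ (x ^ i) _ _ (begin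
          x ^ i ∙ x ^ (j ∸ i)   ≡⟨ sym (^-+ x i (j ∸ i)) ⟩
          x ^ (i + (j ∸ i))     ≡⟨ cong (x ^_) (m+[n∸m]≡n (<⇒≤ i<j)) ⟩
          x ^ j                 ≡⟨ sym eq ⟩
          x ^ i                 ≡⟨ sym (identityʳ _) ⟩
          x ^ i ∙ ε             ∎)))

    ^-injective : ∀ {i j : Fin m} → x ^ toℕ i ≡ x ^ toℕ j → i ≡ j
    ^-injective {i} {j} eq with <-cmp (toℕ i) (toℕ j)
    ... | tri< i<j _ _ = contradiction eq (not-< i<j (toℕ<n j))
    ... | tri≈ _ i≡j _ = toℕ-injective i≡j
    ... | tri> _ _ j<i = contradiction (sym eq) (not-< j<i (toℕ<n i))

    -- Lagrange's theorem for ⟨x⟩: the powers below `m` are distinct, so the right cosets ⟨x⟩y are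
    -- blocks of size `m`.
    order∣n : m ∣ n
    order∣n = subst (m ∣_) (length-tabulate {n = n} (λ i → i)) (blocks⇒∣length _≟_ m coset (allFin n) (Unique.allFin⁺ n) record
      { size   = λ {y} _ → length-tabulate {n = m} (λ i → x ^ toℕ i ∙ y)
      ; unique = λ {y} _ → Unique.tabulate⁺ λ eq → ^-injective (∙-cancelʳ y _ _ eq)
      ; self   = λ {y} _ → subst (_∈ coset y) (identityˡ y) (coset⁺ 0)
      ; inside = λ _ _ → ∈-allFin _
      ; meet   = λ {y} {u} {z} _ _ u∈y u∈z → meets (∈-tabulate⁻ u∈y) (∈-tabulate⁻ u∈z)
      })
      where
      coset : Fin n → List (Fin n)
      coset y = tabulate {n = m} λ i → x ^ toℕ i ∙ y
      coset⁺ : ∀ {y} k → x ^ k ∙ y ∈ coset y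
      coset⁺ {y} k = subst (_∈ coset y) (cong (_∙ y) (sym (^-mod m xᵐ k))) (∈-tabulate⁺ (k mod m))
      meets : ∀ {y u z} → (∃ λ (i : Fin m) → u ≡ x ^ toℕ i ∙ y) → (∃ λ (j : Fin m) → u ≡ x ^ toℕ j ∙ z) → z ∈ coset y
      -- From xⁱy = xʲz one gets z = xⁱ⁻ʲy; the exponent m - j + i represents i - j modulo m without
      -- truncation.
      meets {y} {u} {z} (i , p) (j , q) = subst (_∈ coset y) (∙-cancelˡ (x ^ toℕ j) _ _ (begin
        x ^ toℕ j ∙ (x ^ (m ∸ toℕ j + toℕ i) ∙ y)   ≡⟨ sym (assoc _ _ _) ⟩
        x ^ toℕ j ∙ x ^ (m ∸ toℕ j + toℕ i) ∙ y     ≡⟨ cong (_∙ y) (begin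
          x ^ toℕ j ∙ x ^ (m ∸ toℕ j + toℕ i)         ≡⟨ cong (x ^ toℕ j ∙_) (^-+ x (m ∸ toℕ j) (toℕ i)) ⟩
          x ^ toℕ j ∙ (x ^ (m ∸ toℕ j) ∙ x ^ toℕ i)   ≡⟨ sym (assoc _ _ _) ⟩
          x ^ toℕ j ∙ x ^ (m ∸ toℕ j) ∙ x ^ toℕ i     ≡⟨ cong (_∙ x ^ toℕ i) (sym (^-+ x (toℕ j) (m ∸ toℕ j))) ⟩
          x ^ (toℕ j + (m ∸ toℕ j)) ∙ x ^ toℕ i       ≡⟨ cong (λ k → x ^ k ∙ x ^ toℕ i) (m+[n∸m]≡n (<⇒≤ (toℕ<n j))) ⟩
          x ^ m ∙ x ^ toℕ i                           ≡⟨ cong (_∙ x ^ toℕ i) xᵐ ⟩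
          ε ∙ x ^ toℕ i                               ≡⟨ identityˡ _ ⟩
          x ^ toℕ i                                   ∎) ⟩
        x ^ toℕ i ∙ y                               ≡⟨ sym p ⟩
        u                                           ≡⟨ q ⟩
        x ^ toℕ j ∙ z                               ∎)) (coset⁺ (m ∸ toℕ j + toℕ i))

length-cartesianProductWith : ∀ {A B D : Set} (f : A → B → D) xs ys →
  length (cartesianProductWith f xs ys) ≡ length xs * length ys
length-cartesianProductWith f []       ys = refl
length-cartesianProductWith f (x ∷ xs) ys =
  trans (length-++ (map (f x) ys)) (cong₂ _+_ (length-map (f x) ys) (length-cartesianProductWith f xs ys))

-- Words in the generators of a Hurwitz group

-- Appends a letter to a stack with free cancellation and the rules C⁴ = C⁻³ and C⁻⁴ = C³, which
-- keep powers of C short.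
push : Word → Letter → Word
push (a ∷ s)         a = s
push (c ∷ s)         c̄ = s
push (c̄ ∷ s)         c = s
push (c ∷ c ∷ c ∷ s) c = c̄ ∷ c̄ ∷ c̄ ∷ s
push (c̄ ∷ c̄ ∷ c̄ ∷ s) c̄ = c ∷ c ∷ c ∷ s
push s               g = g ∷ s

reduce : Word → Word
reduce w = reverse (foldl push [] w)

_^ʷ_ : Word → ℕ → Word
w ^ʷ zero  = []
w ^ʷ suc k = w ++ w ^ʷ k

-- b̂ stands for B = AC⁻¹.
b̂ mirrorWord : Word
b̂ = a ∷ c̄ ∷ []
mirrorWord = reduce ((((((b̂ ^ʷ 2) ++ c ∷ []) ++ b̂ ^ʷ 2) ++ (c ∷ []) ^ʷ 4) ++ b̂) ++ (c ∷ []) ^ʷ 4)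

conjRelator : ℕ → Word → Word
conjRelator k u = u ++ c ∷ invert u ++ (c̄ ∷ []) ^ʷ k

module Words {n : ℕ} (G : FinGroup n) (h : HurwitzTriple G) where
  open FinGroupProperties G public
  open HurwitzTriple h public
  open ≡-Reasoning

  ⟦_⟧ˡ : Letter → Fin n
  ⟦ a ⟧ˡ = A
  ⟦ c ⟧ˡ = C
  ⟦ c̄ ⟧ˡ = C ⁻¹

  ⟦_⟧ : Word → Fin n
  ⟦ [] ⟧    = ε
  ⟦ g ∷ w ⟧ = ⟦ g ⟧ˡ ∙ ⟦ w ⟧

  -- For words written with their last letter first.
  ⟪_⟫ : Word → Fin n
  ⟪ [] ⟫    = ε
  ⟪ g ∷ k ⟫ = ⟪ k ⟫ ∙ ⟦ g ⟧ˡ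

  ⟪⟫-ʳ++ : ∀ w k → ⟪ w ʳ++ k ⟫ ≡ ⟪ k ⟫ ∙ ⟦ w ⟧
  ⟪⟫-ʳ++ []      k = sym (identityʳ _)
  ⟪⟫-ʳ++ (g ∷ w) k = trans (⟪⟫-ʳ++ w (g ∷ k)) (assoc _ _ _)

  ⟪⟫-++ : ∀ u v → ⟪ u ++ v ⟫ ≡ ⟪ v ⟫ ∙ ⟪ u ⟫
  ⟪⟫-++ []      v = sym (identityʳ _)
  ⟪⟫-++ (g ∷ u) v = trans (cong (_∙ ⟦ g ⟧ˡ) (⟪⟫-++ u v)) (assoc _ _ _)

  ⟦⟧-++ : ∀ u v → ⟦ u ++ v ⟧ ≡ ⟦ u ⟧ ∙ ⟦ v ⟧
  ⟦⟧-++ []      v = sym (identityˡ _)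
  ⟦⟧-++ (g ∷ u) v = trans (cong (⟦ g ⟧ˡ ∙_) (⟦⟧-++ u v)) (sym (assoc _ _ _))

  ⟦⟧-^ʷ : ∀ w k → ⟦ w ^ʷ k ⟧ ≡ ⟦ w ⟧ ^ k
  ⟦⟧-^ʷ w zero    = refl
  ⟦⟧-^ʷ w (suc k) = trans (⟦⟧-++ w (w ^ʷ k)) (cong (⟦ w ⟧ ∙_) (⟦⟧-^ʷ w k))

  ⟪⟫-reverse : ∀ w → ⟪ reverse w ⟫ ≡ ⟦ w ⟧
  ⟪⟫-reverse w = trans (⟪⟫-ʳ++ w []) (identityˡ _)

  ⟦⟧-reverse : ∀ w → ⟦ reverse w ⟧ ≡ ⟪ w ⟫
  ⟦⟧-reverse []      = refl
  ⟦⟧-reverse (g ∷ w) = begin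
    ⟦ reverse (g ∷ w) ⟧           ≡⟨ cong ⟦_⟧ (unfold-reverse g w) ⟩
    ⟦ reverse w ++ g ∷ [] ⟧       ≡⟨ ⟦⟧-++ (reverse w) (g ∷ []) ⟩
    ⟦ reverse w ⟧ ∙ (⟦ g ⟧ˡ ∙ ε)  ≡⟨ cong₂ _∙_ (⟦⟧-reverse w) (identityʳ _) ⟩
    ⟪ w ⟫ ∙ ⟦ g ⟧ˡ                ∎

  A∙A : A ∙ A ≡ ε
  A∙A = trans (cong (A ∙_) (sym (identityʳ A))) A²

  A⁻¹≡A : A ⁻¹ ≡ A
  A⁻¹≡A = sym (inverseˡ-unique A A A∙A)

  ⟦opp⟧ˡ : ∀ g → ⟦ opp g ⟧ˡ ≡ ⟦ g ⟧ˡ ⁻¹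
  ⟦opp⟧ˡ a = sym A⁻¹≡A
  ⟦opp⟧ˡ c = refl
  ⟦opp⟧ˡ c̄ = sym (⁻¹-involutive C)

  ⟪opp⟫ : ∀ w → ⟪ map opp w ⟫ ≡ ⟦ w ⟧ ⁻¹
  ⟪opp⟫ []      = sym ε⁻¹≈ε
  ⟪opp⟫ (g ∷ w) = trans (cong₂ _∙_ (⟪opp⟫ w) (⟦opp⟧ˡ g)) (sym (⁻¹-anti-homo-∙ _ _))

  ⟦invert⟧ : ∀ w → ⟦ invert w ⟧ ≡ ⟦ w ⟧ ⁻¹
  ⟦invert⟧ w = trans (⟦⟧-reverse (map opp w)) (⟪opp⟫ w)

  letter-cancel : ∀ x g → x ∙ ⟦ g ⟧ˡ ∙ ⟦ opp g ⟧ˡ ≡ x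
  letter-cancel x g = trans (cong (x ∙ ⟦ g ⟧ˡ ∙_) (⟦opp⟧ˡ g)) (inverse-cancelʳ x ⟦ g ⟧ˡ)

  C⁻¹^7 : (C ⁻¹) ^ 7 ≡ ε
  C⁻¹^7 = begin
    (C ⁻¹) ^ 7               ≡⟨ cong (_^ 7) (sym (identityʳ _)) ⟩
    ⟦ c̄ ∷ [] ⟧ ^ 7           ≡⟨ sym (⟦⟧-^ʷ (c̄ ∷ []) 7) ⟩
    ⟦ (c̄ ∷ []) ^ʷ 7 ⟧        ≡⟨ ⟦invert⟧ ((c ∷ []) ^ʷ 7) ⟩
    ⟦ (c ∷ []) ^ʷ 7 ⟧ ⁻¹     ≡⟨ cong _⁻¹ C⁷ ⟩
    ε ⁻¹                     ≡⟨ ε⁻¹≈ε ⟩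
    ε                        ∎

  B≡A∙C⁻¹ : B ≡ A ∙ C ⁻¹
  B≡A∙C⁻¹ = begin
    B                     ≡⟨ sym (inverse-cancelʳ B C) ⟩
    B ∙ C ∙ C ⁻¹          ≡⟨ cong (_∙ C ⁻¹) (inverseʳ-unique A (B ∙ C) (trans (sym (assoc _ _ _)) ABC)) ⟩
    A ⁻¹ ∙ C ⁻¹           ≡⟨ cong (_∙ C ⁻¹) A⁻¹≡A ⟩
    A ∙ C ⁻¹              ∎

  ⟦b̂⟧ : ⟦ b̂ ⟧ ≡ B
  ⟦b̂⟧ = trans (cong (A ∙_) (identityʳ _)) (sym B≡A∙C⁻¹)

  ⟦c⟧ : ⟦ c ∷ [] ⟧ ≡ C
  ⟦c⟧ = identityʳ C

  ⟪⟫-7 : ∀ g k → ⟦ g ⟧ˡ ^ 7 ≡ ε → ⟪ g ∷ g ∷ g ∷ g ∷ g ∷ g ∷ g ∷ k ⟫ ≡ ⟪ k ⟫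
  ⟪⟫-7 g k g⁷ = trans (⟪⟫-ʳ++ (g ∷ g ∷ g ∷ g ∷ g ∷ g ∷ g ∷ []) k) (trans (cong (⟪ k ⟫ ∙_) g⁷) (identityʳ _))

  -- Insert g⁷ = 1 and cancel three of its letters.
  ⟪⟫-4 : ∀ g k → ⟦ g ⟧ˡ ^ 7 ≡ ε → ⟪ opp g ∷ opp g ∷ opp g ∷ k ⟫ ≡ ⟪ g ∷ g ∷ g ∷ g ∷ k ⟫
  ⟪⟫-4 g k g⁷ = begin
    ⟪ opp g ∷ opp g ∷ opp g ∷ k ⟫              ≡⟨ cong (λ x → x ∙ o ∙ o ∙ o) (sym (⟪⟫-7 g k g⁷)) ⟩
    y ∙ p ∙ p ∙ p ∙ o ∙ o ∙ o                  ≡⟨ cong (λ x → x ∙ o ∙ o) (letter-cancel (y ∙ p ∙ p) g) ⟩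
    y ∙ p ∙ p ∙ o ∙ o                          ≡⟨ cong (_∙ o) (letter-cancel (y ∙ p) g) ⟩
    y ∙ p ∙ o                                  ≡⟨ letter-cancel y g ⟩
    y                                          ∎
    where
    p = ⟦ g ⟧ˡ
    o = ⟦ opp g ⟧ˡ
    y = ⟪ g ∷ g ∷ g ∷ g ∷ k ⟫

  ⟪push⟫ : ∀ s g → ⟪ push s g ⟫ ≡ ⟪ s ⟫ ∙ ⟦ g ⟧ˡ
  ⟪push⟫ []                  a = refl
  ⟪push⟫ []                  c = refl
  ⟪push⟫ []                  c̄ = refl
  ⟪push⟫ (a ∷ s)             a = sym (letter-cancel ⟪ s ⟫ a)
  ⟪push⟫ (a ∷ s)             c = refl
  ⟪push⟫ (a ∷ s)             c̄ = refl
  ⟪push⟫ (c ∷ s)             a = refl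
  ⟪push⟫ (c ∷ s)             c̄ = sym (letter-cancel ⟪ s ⟫ c)
  ⟪push⟫ (c ∷ [])            c = refl
  ⟪push⟫ (c ∷ a ∷ s)         c = refl
  ⟪push⟫ (c ∷ c̄ ∷ s)         c = refl
  ⟪push⟫ (c ∷ c ∷ [])        c = refl
  ⟪push⟫ (c ∷ c ∷ a ∷ s)     c = refl
  ⟪push⟫ (c ∷ c ∷ c̄ ∷ s)     c = refl
  ⟪push⟫ (c ∷ c ∷ c ∷ s)     c = ⟪⟫-4 c s C⁷
  ⟪push⟫ (c̄ ∷ s)             a = refl
  ⟪push⟫ (c̄ ∷ s)             c = sym (letter-cancel ⟪ s ⟫ c̄)
  ⟪push⟫ (c̄ ∷ [])            c̄ = refl
  ⟪push⟫ (c̄ ∷ a ∷ s)         c̄ = refl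
  ⟪push⟫ (c̄ ∷ c ∷ s)         c̄ = refl
  ⟪push⟫ (c̄ ∷ c̄ ∷ [])        c̄ = refl
  ⟪push⟫ (c̄ ∷ c̄ ∷ a ∷ s)     c̄ = refl
  ⟪push⟫ (c̄ ∷ c̄ ∷ c ∷ s)     c̄ = refl
  ⟪push⟫ (c̄ ∷ c̄ ∷ c̄ ∷ s)     c̄ = ⟪⟫-4 c̄ s C⁻¹^7

  ⟪foldl-push⟫ : ∀ s w → ⟪ foldl push s w ⟫ ≡ ⟪ s ⟫ ∙ ⟦ w ⟧
  ⟪foldl-push⟫ s []      = sym (identityʳ _)
  ⟪foldl-push⟫ s (g ∷ w) =
    trans (⟪foldl-push⟫ (push s g) w) (trans (cong (_∙ ⟦ w ⟧) (⟪push⟫ s g)) (assoc _ _ _))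

  ⟦reduce⟧ : ∀ w → ⟦ reduce w ⟧ ≡ ⟦ w ⟧
  ⟦reduce⟧ w = trans (⟦⟧-reverse (foldl push [] w)) (trans (⟪foldl-push⟫ [] w) (identityˡ _))

  ⟦mirrorWord⟧ : ⟦ mirrorWord ⟧ ≡ mirror G h
  -- `raw` assembles the unreduced word alongside its value; its first component is definitionally
  -- the word that `mirrorWord` reduces.
  ⟦mirrorWord⟧ = trans (⟦reduce⟧ (proj₁ raw)) (proj₂ raw)
    where
    infixl 5 _⊕_
    _⊕_ : ∀ {x y} → (∃ λ u → ⟦ u ⟧ ≡ x) → (∃ λ v → ⟦ v ⟧ ≡ y) → ∃ λ w → ⟦ w ⟧ ≡ x ∙ y
    (u , p) ⊕ (v , q) = u ++ v , trans (⟦⟧-++ u v) (cong₂ _∙_ p q)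
    b¹ : ∃ λ w → ⟦ w ⟧ ≡ B
    b¹ = b̂ , ⟦b̂⟧
    b² : ∃ λ w → ⟦ w ⟧ ≡ B ^ 2
    b² = b̂ ^ʷ 2 , trans (⟦⟧-^ʷ b̂ 2) (cong (_^ 2) ⟦b̂⟧)
    c¹ : ∃ λ w → ⟦ w ⟧ ≡ C
    c¹ = c ∷ [] , ⟦c⟧
    c⁴ : ∃ λ w → ⟦ w ⟧ ≡ C ^ 4
    c⁴ = (c ∷ []) ^ʷ 4 , trans (⟦⟧-^ʷ (c ∷ []) 4) (cong (_^ 4) ⟦c⟧)
    raw : ∃ λ w → ⟦ w ⟧ ≡ mirror G h
    raw = b² ⊕ c¹ ⊕ b² ⊕ c⁴ ⊕ b¹ ⊕ c⁴

  ⟦mirrorWord^⟧ : ∀ k → ⟦ mirrorWord ^ʷ k ⟧ ≡ mirror G h ^ k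
  ⟦mirrorWord^⟧ k = trans (⟦⟧-^ʷ mirrorWord k) (cong (_^ k) ⟦mirrorWord⟧)

  word : ∀ x → ∃ λ w → ⟦ w ⟧ ≡ x
  word x = go (generates x)
    where
    go : ∀ {x} → InSubgroup G (λ y → (y ≡ A ⊎ y ≡ B) ⊎ y ≡ C) x → ∃ λ w → ⟦ w ⟧ ≡ x
    go (gen (inj₁ (inj₁ refl))) = a ∷ [] , identityʳ A
    go (gen (inj₁ (inj₂ refl))) = b̂ , ⟦b̂⟧
    go (gen (inj₂ refl))        = c ∷ [] , ⟦c⟧
    go unit                     = [] , refl
    go (mul p q) with go p | go q
    ... | u , refl | v , refl   = u ++ v , ⟦⟧-++ u v
    go (inv p) with go p
    ... | u , refl              = invert u , ⟦invert⟧ u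

  -- Equality of the right cosets of ⟨C⟩ named by the two words. Natural exponents suffice, since
  -- C⁶ⁱ is the inverse of Cⁱ.
  _≈_ : Word → Word → Set
  k ≈ v = ∃ λ i → ⟪ k ⟫ ≡ C ^ i ∙ ⟪ v ⟫

  ≡⇒≈ : ∀ k v → ⟪ k ⟫ ≡ ⟪ v ⟫ → k ≈ v
  ≡⇒≈ k v eq = 0 , trans eq (sym (identityˡ _))

  C^-cancel : ∀ i x → C ^ (6 * i) ∙ (C ^ i ∙ x) ≡ x
  C^-cancel i x = begin
    C ^ (6 * i) ∙ (C ^ i ∙ x)   ≡⟨ sym (assoc _ _ _) ⟩
    C ^ (6 * i) ∙ C ^ i ∙ x     ≡⟨ cong (_∙ x) (^-comm C (6 * i) i) ⟩
    C ^ i ∙ C ^ (6 * i) ∙ x     ≡⟨ cong (_∙ x) (sym (^-+ C i (6 * i))) ⟩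
    C ^ (7 * i) ∙ x             ≡⟨ cong (_∙ x) (trans (cong (C ^_) (*-comm 7 i)) (^-multiple i C⁷)) ⟩
    ε ∙ x                       ≡⟨ identityˡ x ⟩
    x                           ∎

  ≈-isEquivalence : IsEquivalence _≈_
  ≈-isEquivalence = record
    { refl  = λ {k} → ≡⇒≈ k k refl
    ; sym   = λ { {k} {v} (i , eq) → 6 * i , sym (trans (cong (C ^ (6 * i) ∙_) eq) (C^-cancel i ⟪ v ⟫)) }
    ; trans = λ { {k} {v} {w} (i , p) (j , q) → i + j ,
        trans p (trans (cong (C ^ i ∙_) q) (trans (sym (assoc _ _ _)) (cong (_∙ ⟪ w ⟫) (sym (^-+ C i j))))) }
    }

  open Soundness _≈_ ≈-isEquivalence
    (λ g (i , eq) → i , trans (cong (_∙ ⟦ g ⟧ˡ) eq) (assoc _ _ _))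
    (λ g k → ≡⇒≈ (opp g ∷ g ∷ k) k (letter-cancel ⟪ k ⟫ g))

  relator : ∀ r → ⟦ r ⟧ ≡ ε → Relator r
  relator r r≡ε k = ≡⇒≈ (r ʳ++ k) k (trans (⟪⟫-ʳ++ r k) (trans (cong (⟪ k ⟫ ∙_) r≡ε) (identityʳ _)))

  Trivial : List Word → Set
  Trivial = All (λ r → ⟦ r ⟧ ≡ ε)

  relators : ∀ {rs} → Trivial rs → All Relator rs
  relators = All.map (λ {r} → relator r)

  valid : ∀ rs → Trivial rs → Valid (cosetTable rs)
  valid rs ps = valid-cosetTable rs (1 , trans (identityˡ C) (sym (trans (identityʳ _) (identityʳ C))))
    (relators (A² ∷ C⁷ ∷ trans (⟦⟧-^ʷ b̂ 3) (trans (cong (_^ 3) ⟦b̂⟧) B³) ∷ [])) (relators ps)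

  -- The products Cⁱ⟪k⟫ with i < 7 cover the group. This gives only an upper bound, as further
  -- relations of G may identify listed cosets.
  index-bound : ∀ rs ks → Trivial rs → closed (cosetTable rs) ks ≡ true → n ≤ 7 * length ks
  index-bound rs ks ps eq = subst₂ _≤_ (length-tabulate {n = n} (λ i → i)) (length-cartesianProductWith f (allFin 7) ks)
    (unique-⊆⇒length≤ (Unique.allFin⁺ n) λ {x} _ → covered x)
    where
    f : Fin 7 → Word → Fin n
    f i k = C ^ toℕ i ∙ ⟪ k ⟫
    covered : ∀ x → x ∈ cartesianProductWith f (allFin 7) ks
    covered x with word x
    ... | w , refl with closed-≈ (cosetTable rs) ks (valid rs ps) eq (reverse w)
    ...   | k , k∈ , i , w≈ = subst (_∈ cartesianProductWith f (allFin 7) ks)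
              (trans (cong (_∙ ⟪ k ⟫) (sym (^-mod 7 C⁷ i))) (trans (sym w≈) (⟪⟫-reverse w)))
              (∈-cartesianProductWith⁺ f (∈-allFin (i mod 7)) k∈)

  collapsed⇒A≡C^ : ∀ rs → Trivial rs → collapsed (cosetTable rs) ≡ true → ∃ λ i → A ≡ C ^ i
  collapsed⇒A≡C^ rs ps eq with collapsed-≈ (cosetTable rs) (valid rs ps) eq
  ... | i , eq′ = i , trans (sym (identityˡ A)) (trans eq′ (identityʳ _))

  fixes⇒ : ∀ rs w → Trivial rs → fixes w (cosetTable rs) ≡ true →
    ∃ λ i → ∃ λ j → ⟦ w ⟧ ≡ C ^ i × A ∙ ⟦ w ⟧ ≡ C ^ j ∙ A
  fixes⇒ rs w ps eq
    with loop-≈ (cosetTable rs) []       w (valid rs ps) (∧-conicalˡ _ _ eq)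
       | loop-≈ (cosetTable rs) (a ∷ []) w (valid rs ps) (∧-conicalʳ (loop (cosetTable rs) [] w) _ eq)
  ... | i , p | j , q = i , j ,
    trans (sym (⟪⟫-reverse w)) (trans p (identityʳ _)) ,
    (begin
      A ∙ ⟦ w ⟧           ≡⟨ cong (_∙ ⟦ w ⟧) (sym (identityˡ A)) ⟩
      ε ∙ A ∙ ⟦ w ⟧       ≡⟨ sym (⟪⟫-ʳ++ w (a ∷ [])) ⟩
      ⟪ w ʳ++ a ∷ [] ⟫    ≡⟨ q ⟩
      C ^ j ∙ (ε ∙ A)     ≡⟨ cong (C ^ j ∙_) (identityˡ A) ⟩
      C ^ j ∙ A           ∎)

-- The normaliser of ⟨C⟩

stripC : Word → Word
stripC (c ∷ s) = stripC s
stripC (c̄ ∷ s) = stripC s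
stripC s       = s

-- Whether w conjugates C to Cᵏ depends only on ⟨C⟩w⟨C⟩, so powers of C are stripped at both ends.
-- Many quotients then agree and share one enumeration.
doubleCosetForm : Word → Word
doubleCosetForm w = stripC (reverse (stripC (foldl push [] w)))

-- The quotient u⁻¹v decides whether u and v lie in the same left coset of the normaliser.
differences : List Word → List Word
differences []       = []
differences (u ∷ us) = map (λ v → invert u ++ v) us ++ differences us

opaque
  doubleCosets : List Word → List Word
  doubleCosets us = deduplicate _≟ʷ_ (map doubleCosetForm (differences us))

  ∈-doubleCosets : ∀ us {w} → w ∈ differences us → doubleCosetForm w ∈ doubleCosets us
  ∈-doubleCosets us w∈ = ∈-deduplicate⁺ _≟ʷ_ (∈-map⁺ doubleCosetForm w∈)

checkConj : (Table → Bool) → List ℕ → List Word → Bool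
checkConj verdict ks us = all (λ u → all (λ k → verdict (cosetTable (conjRelator k u ∷ []))) ks) us

opaque
  unfolding cosetTable

  c-collapses : collapsed (cosetTable ((c ∷ []) ∷ [])) ≡ true
  c-collapses = refl

  conj-a-collapses : checkConj collapsed (upTo 7) ((a ∷ []) ∷ []) ≡ true
  conj-a-collapses = refl

reaches-7-1 : Reaches 7 1
reaches-7-1 = from-yes (reaches? 7 1)

module Normaliser {n : ℕ} (G : FinGroup n) (h : HurwitzTriple G) (nontrivial : 1 < n) where
  open Words G h public
  open ≡-Reasoning

  -- If A = Cⁱ, then A = A⁷ = C⁷ⁱ = 1. So B = C⁻¹ has order dividing both 3 and 7, and all
  -- generators are trivial.
  A≢C^ : ¬ (∃ λ i → A ≡ C ^ i)
  A≢C^ (i , A≡Cⁱ) = absurd nontrivial λ x → trans (sym (proj₂ (word x))) (⟦⟧≡ε (proj₁ (word x)))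
    where
    A≡ε : A ≡ ε
    A≡ε = begin
      A             ≡⟨ sym (identityʳ A) ⟩
      A ^ 1         ≡⟨ sym (^-% 2 A² 7) ⟩
      A ^ 7         ≡⟨ cong (_^ 7) A≡Cⁱ ⟩
      (C ^ i) ^ 7   ≡⟨ sym (^-* C 7 i) ⟩
      C ^ (7 * i)   ≡⟨ cong (C ^_) (*-comm 7 i) ⟩
      C ^ (i * 7)   ≡⟨ ^-multiple i C⁷ ⟩
      ε             ∎
    B≡C⁻¹ : B ≡ C ⁻¹
    B≡C⁻¹ = trans B≡A∙C⁻¹ (trans (cong (_∙ C ⁻¹) A≡ε) (identityˡ _))
    B≡ε : B ≡ ε
    B≡ε = begin
      B             ≡⟨ sym (^-1 B) ⟩
      B ^ 1         ≡⟨ sym (^-% 3 B³ 7) ⟩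
      B ^ 7         ≡⟨ cong (_^ 7) B≡C⁻¹ ⟩
      (C ⁻¹) ^ 7    ≡⟨ C⁻¹^7 ⟩
      ε             ∎
    C⁻¹≡ε : C ⁻¹ ≡ ε
    C⁻¹≡ε = trans (sym B≡C⁻¹) B≡ε
    ⟦⟧≡ε : ∀ w → ⟦ w ⟧ ≡ ε
    ⟦⟧≡ε []      = refl
    ⟦⟧≡ε (g ∷ w) = trans (cong₂ _∙_ (letter g) (⟦⟧≡ε w)) (identityˡ ε)
      where
      letter : ∀ g → ⟦ g ⟧ˡ ≡ ε
      letter a = A≡ε
      letter c = trans (sym (⁻¹-involutive C)) (trans (cong _⁻¹ C⁻¹≡ε) ε⁻¹≈ε)
      letter c̄ = C⁻¹≡ε
    absurd : ∀ {m} {e : Fin m} → 1 < m → (∀ x → x ≡ e) → ⊥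
    absurd (s≤s (s≤s _)) all≡ with trans (all≡ zero) (sym (all≡ (suc zero)))
    ... | ()

  refute : ∀ rs → Trivial rs → collapsed (cosetTable rs) ≡ true → ⊥
  refute rs ps eq = A≢C^ (collapsed⇒A≡C^ rs ps eq)

  C≢ε : C ≢ ε
  C≢ε C≡ε = refute ((c ∷ []) ∷ []) (trans ⟦c⟧ C≡ε ∷ []) c-collapses

  C^1≢ε : C ^ 1 ≢ ε
  C^1≢ε eq = C≢ε (trans (sym (^-1 C)) eq)

  C^-injective : ∀ {i j : Fin 7} → C ^ toℕ i ≡ C ^ toℕ j → i ≡ j
  C^-injective = ^-injective C⁷ C^1≢ε reaches-7-1

  C^-mod-injective : ∀ i j → C ^ i ≡ C ^ j → i mod 7 ≡ j mod 7
  C^-mod-injective i j eq = C^-injective (trans (sym (^-mod 7 C⁷ i)) (trans eq (^-mod 7 C⁷ j)))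

  Conj : ℕ → Fin n → Set
  Conj k x = x ∙ C ≡ C ^ k ∙ x

  -- Membership in the normaliser of ⟨C⟩, tested on the generator C with exponents taken modulo 7 to
  -- make it decidable. The exponent 0 never occurs, by `conj-nonzero`.
  N : Fin n → Set
  N x = ∃ λ (k : Fin 7) → Conj (toℕ k) x

  N? : Decidable N
  N? x = any? λ k → _ ≟ _

  conj⇒N : ∀ {x} k → Conj k x → N x
  conj⇒N {x} k eq = k mod 7 , trans eq (cong (_∙ x) (^-mod 7 C⁷ k))

  conj-unique : ∀ {i j x} → Conj i x → Conj j x → i mod 7 ≡ j mod 7
  conj-unique {i} {j} {x} p q = C^-mod-injective i j (∙-cancelʳ x _ _ (trans (sym p) q))

  conj-nonzero : ∀ {x} → ¬ Conj 0 x
  conj-nonzero {x} eq = C≢ε (∙-cancelˡ x C ε (trans eq (trans (identityˡ x) (sym (identityʳ x)))))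

  intertwine-^ : ∀ {x y z} → x ∙ y ≡ z ∙ x → ∀ e → x ∙ y ^ e ≡ z ^ e ∙ x
  intertwine-^ {x} eq zero    = trans (identityʳ x) (sym (identityˡ x))
  intertwine-^ {x} {y} {z} eq (suc e) = begin
    x ∙ (y ∙ y ^ e)   ≡⟨ sym (assoc _ _ _) ⟩
    x ∙ y ∙ y ^ e     ≡⟨ cong (_∙ y ^ e) eq ⟩
    z ∙ x ∙ y ^ e     ≡⟨ assoc _ _ _ ⟩
    z ∙ (x ∙ y ^ e)   ≡⟨ cong (z ∙_) (intertwine-^ eq e) ⟩
    z ∙ (z ^ e ∙ x)   ≡⟨ sym (assoc _ _ _) ⟩
    z ∙ z ^ e ∙ x     ∎

  conj-∙ : ∀ {x y} i j → Conj i x → Conj j y → Conj (j * i) (x ∙ y)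
  conj-∙ {x} {y} i j p q = begin
    x ∙ y ∙ C             ≡⟨ assoc _ _ _ ⟩
    x ∙ (y ∙ C)           ≡⟨ cong (x ∙_) q ⟩
    x ∙ (C ^ j ∙ y)       ≡⟨ sym (assoc _ _ _) ⟩
    x ∙ C ^ j ∙ y         ≡⟨ cong (_∙ y) (intertwine-^ p j) ⟩
    (C ^ i) ^ j ∙ x ∙ y   ≡⟨ cong (λ z → z ∙ x ∙ y) (sym (^-* C j i)) ⟩
    C ^ (j * i) ∙ x ∙ y   ≡⟨ assoc _ _ _ ⟩
    C ^ (j * i) ∙ (x ∙ y) ∎

  conj-C^ : ∀ i → Conj 1 (C ^ i)
  conj-C^ i = trans (cong (C ^ i ∙_) (sym (^-1 C))) (^-comm C i 1)

  -- As 7 is prime, any Cᵈ ≠ 1 generates ⟨C⟩; raising the relation to a power e with ed ≡ 1 (mod 7)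
  -- recovers C.
  power-intertwine⇒N : ∀ {x} d l → C ^ d ≢ ε → x ∙ C ^ d ≡ C ^ l ∙ x → N x
  power-intertwine⇒N {x} d l Cᵈ≢ε eq with reaches-7-1 (d mod 7)
  ... | inj₁ d≡0      = contradiction (trans (^-mod 7 C⁷ d) (cong (C ^_) d≡0)) Cᵈ≢ε
  ... | inj₂ (e , e≡) = conj⇒N (toℕ e * l) (begin
    x ∙ C                          ≡⟨ cong (x ∙_) (sym Cᵈᵉ) ⟩
    x ∙ (C ^ d) ^ toℕ e            ≡⟨ intertwine-^ eq (toℕ e) ⟩
    (C ^ l) ^ toℕ e ∙ x            ≡⟨ cong (_∙ x) (sym (^-* C (toℕ e) l)) ⟩
    C ^ (toℕ e * l) ∙ x            ∎)
    where
    Cᵈᵉ : (C ^ d) ^ toℕ e ≡ C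
    Cᵈᵉ = begin
      (C ^ d) ^ toℕ e                        ≡⟨ cong (_^ toℕ e) (^-mod 7 C⁷ d) ⟩
      (C ^ toℕ (d mod 7)) ^ toℕ e            ≡⟨ sym (^-* C (toℕ e) (toℕ (d mod 7))) ⟩
      C ^ (toℕ e * toℕ (d mod 7))            ≡⟨ ^-% 7 C⁷ (toℕ e * toℕ (d mod 7)) ⟩
      C ^ ((toℕ e * toℕ (d mod 7)) % 7)      ≡⟨ cong (C ^_) e≡ ⟩
      C ^ 1                                  ≡⟨ ^-1 C ⟩
      C                                      ∎

  conj-cancelʳ : ∀ {x y} k → y ∙ C ≡ C ∙ y → Conj k (x ∙ y) → Conj k x
  conj-cancelʳ {x} {y} k comm eq = ∙-cancelʳ y _ _ (begin
    x ∙ C ∙ y         ≡⟨ assoc _ _ _ ⟩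
    x ∙ (C ∙ y)       ≡⟨ cong (x ∙_) (sym comm) ⟩
    x ∙ (y ∙ C)       ≡⟨ sym (assoc _ _ _) ⟩
    x ∙ y ∙ C         ≡⟨ eq ⟩
    C ^ k ∙ (x ∙ y)   ≡⟨ sym (assoc _ _ _) ⟩
    C ^ k ∙ x ∙ y     ∎)

  conj-cancelˡ : ∀ {x y} k → y ∙ C ≡ C ∙ y → Conj k (y ∙ x) → Conj k x
  conj-cancelˡ {x} {y} k comm eq = ∙-cancelˡ y _ _ (begin
    y ∙ (x ∙ C)       ≡⟨ sym (assoc _ _ _) ⟩
    y ∙ x ∙ C         ≡⟨ eq ⟩
    C ^ k ∙ (y ∙ x)   ≡⟨ sym (assoc _ _ _) ⟩
    C ^ k ∙ y ∙ x     ≡⟨ cong (_∙ x) (sym (intertwine-^ comm k)) ⟩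
    y ∙ C ^ k ∙ x     ≡⟨ assoc _ _ _ ⟩
    y ∙ (C ^ k ∙ x)   ∎)

  C⁻¹-comm : C ⁻¹ ∙ C ≡ C ∙ C ⁻¹
  C⁻¹-comm = trans (inverseˡ C) (sym (inverseʳ C))

  C^-comm : ∀ i → C ^ i ∙ C ≡ C ∙ C ^ i
  C^-comm i = trans (conj-C^ i) (cong (_∙ C ^ i) (^-1 C))

  conj-stripC-⟪⟫ : ∀ k s → Conj k ⟪ s ⟫ → Conj k ⟪ stripC s ⟫
  conj-stripC-⟪⟫ k []      p = p
  conj-stripC-⟪⟫ k (a ∷ s) p = p
  conj-stripC-⟪⟫ k (c ∷ s) p = conj-stripC-⟪⟫ k s (conj-cancelʳ k refl p)
  conj-stripC-⟪⟫ k (c̄ ∷ s) p = conj-stripC-⟪⟫ k s (conj-cancelʳ k C⁻¹-comm p)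

  conj-stripC-⟦⟧ : ∀ k s → Conj k ⟦ s ⟧ → Conj k ⟦ stripC s ⟧
  conj-stripC-⟦⟧ k []      p = p
  conj-stripC-⟦⟧ k (a ∷ s) p = p
  conj-stripC-⟦⟧ k (c ∷ s) p = conj-stripC-⟦⟧ k s (conj-cancelˡ k refl p)
  conj-stripC-⟦⟧ k (c̄ ∷ s) p = conj-stripC-⟦⟧ k s (conj-cancelˡ k C⁻¹-comm p)

  conj-doubleCosetForm : ∀ k w → Conj k ⟦ w ⟧ → Conj k ⟦ doubleCosetForm w ⟧
  conj-doubleCosetForm k w p = conj-stripC-⟦⟧ k (reverse (stripC (foldl push [] w))) (subst (Conj k) (sym (⟦⟧-reverse (stripC (foldl push [] w))))
    (conj-stripC-⟪⟫ k (foldl push [] w) (subst (Conj k) (sym (trans (⟪foldl-push⟫ [] w) (identityˡ _))) p)))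

  C^-C⁻¹^ : ∀ k → C ^ k ∙ (C ⁻¹) ^ k ≡ ε
  C^-C⁻¹^ zero    = identityˡ ε
  C^-C⁻¹^ (suc k) = begin
    C ∙ C ^ k ∙ (C ⁻¹ ∙ (C ⁻¹) ^ k)     ≡⟨ cong (_∙ (C ⁻¹ ∙ (C ⁻¹) ^ k)) (sym (C^-comm k)) ⟩
    C ^ k ∙ C ∙ (C ⁻¹ ∙ (C ⁻¹) ^ k)     ≡⟨ sym (assoc _ _ _) ⟩
    C ^ k ∙ C ∙ C ⁻¹ ∙ (C ⁻¹) ^ k       ≡⟨ cong (_∙ (C ⁻¹) ^ k) (inverse-cancelʳ _ C) ⟩
    C ^ k ∙ (C ⁻¹) ^ k                  ≡⟨ C^-C⁻¹^ k ⟩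
    ε                                   ∎

  ⟦conjRelator⟧ : ∀ k u → ⟦ conjRelator k u ⟧ ≡ ⟦ u ⟧ ∙ C ∙ (C ^ k ∙ ⟦ u ⟧) ⁻¹
  ⟦conjRelator⟧ k u = begin
    ⟦ u ++ c ∷ invert u ++ (c̄ ∷ []) ^ʷ k ⟧            ≡⟨ ⟦⟧-++ u _ ⟩
    ⟦ u ⟧ ∙ (C ∙ ⟦ invert u ++ (c̄ ∷ []) ^ʷ k ⟧)       ≡⟨ sym (assoc _ _ _) ⟩
    ⟦ u ⟧ ∙ C ∙ ⟦ invert u ++ (c̄ ∷ []) ^ʷ k ⟧         ≡⟨ cong (⟦ u ⟧ ∙ C ∙_) (⟦⟧-++ (invert u) _) ⟩
    ⟦ u ⟧ ∙ C ∙ (⟦ invert u ⟧ ∙ ⟦ (c̄ ∷ []) ^ʷ k ⟧)    ≡⟨ cong (⟦ u ⟧ ∙ C ∙_) (cong₂ _∙_ (⟦invert⟧ u)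
        (trans (⟦⟧-^ʷ (c̄ ∷ []) k) (trans (cong (_^ k) (identityʳ _)) (inverseʳ-unique _ _ (C^-C⁻¹^ k))))) ⟩
    ⟦ u ⟧ ∙ C ∙ (⟦ u ⟧ ⁻¹ ∙ (C ^ k) ⁻¹)               ≡⟨ cong (⟦ u ⟧ ∙ C ∙_) (sym (⁻¹-anti-homo-∙ _ _)) ⟩
    ⟦ u ⟧ ∙ C ∙ (C ^ k ∙ ⟦ u ⟧) ⁻¹                    ∎

  Conj⇒conjRelator : ∀ k u → Conj k ⟦ u ⟧ → ⟦ conjRelator k u ⟧ ≡ ε
  Conj⇒conjRelator k u p = trans (⟦conjRelator⟧ k u) (trans (cong (_∙ (C ^ k ∙ ⟦ u ⟧) ⁻¹) p) (inverseʳ _))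

  conjRelator⇒Conj : ∀ k u → ⟦ conjRelator k u ⟧ ≡ ε → Conj k ⟦ u ⟧
  conjRelator⇒Conj k u eq = ∙-cancelʳ ((C ^ k ∙ ⟦ u ⟧) ⁻¹) _ _
    (trans (sym (⟦conjRelator⟧ k u)) (trans eq (sym (inverseʳ _))))

  checkConj-sound : ∀ {P : Set} verdict ks us →
    (∀ rs → Trivial rs → verdict (cosetTable rs) ≡ true → P) →
    checkConj verdict ks us ≡ true → ∀ {u k} → u ∈ us → k ∈ ks → Conj k ⟦ u ⟧ → P
  checkConj-sound verdict ks us sound eq {u} {k} u∈ k∈ p =
    sound (conjRelator k u ∷ []) (Conj⇒conjRelator k u p ∷ []) (all-true (test u) (all-true (λ u → all (test u) ks) eq u∈) k∈)
    where
    test : Word → ℕ → Bool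
    test u k = verdict (cosetTable (conjRelator k u ∷ []))

  ¬N-A : ¬ N A
  ¬N-A (k , p) = checkConj-sound collapsed (upTo 7) ((a ∷ []) ∷ []) refute conj-a-collapses
    (here refl) (∈-upTo⁺ (toℕ<n k)) (subst (Conj (toℕ k)) (sym (identityʳ A)) p)

  -- w = Cⁱ and A w A⁻¹ = Cʲ: since A does not normalise ⟨C⟩, this forces w = 1.
  fixes⇒≡ε : ∀ rs w → Trivial rs → fixes w (cosetTable rs) ≡ true → ⟦ w ⟧ ≡ ε
  fixes⇒≡ε rs w ps eq with fixes⇒ rs w ps eq
  ... | i , j , w≡Cⁱ , Aw≡CʲA with C ^ i ≟ ε
  ...   | yes Cⁱ≡ε = trans w≡Cⁱ Cⁱ≡ε
  ...   | no  Cⁱ≢ε = contradiction (power-intertwine⇒N i j Cⁱ≢ε (trans (cong (A ∙_) (sym w≡Cⁱ)) Aw≡CʲA)) ¬N-A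

  -- Double cosets of ⟨C⟩ and the order of the normaliser

  normaliser : List (Fin n)
  normaliser = filter N? (allFin n)

  doubleCoset : Fin n → List (Fin n)
  doubleCoset x = cartesianProductWith (λ i j → C ^ toℕ i ∙ x ∙ C ^ toℕ j) (allFin 7) (allFin 7)

  doubleCoset⁺ : ∀ x i j → C ^ i ∙ x ∙ C ^ j ∈ doubleCoset x
  doubleCoset⁺ x i j = subst (_∈ doubleCoset x)
    (cong₂ (λ y z → y ∙ x ∙ z) (sym (^-mod 7 C⁷ i)) (sym (^-mod 7 C⁷ j)))
    (∈-cartesianProductWith⁺ (λ i j → C ^ toℕ i ∙ x ∙ C ^ toℕ j) (∈-allFin (i mod 7)) (∈-allFin (j mod 7)))

  doubleCoset⁻ : ∀ {x y} → y ∈ doubleCoset x → ∃₂ λ (i j : Fin 7) → y ≡ C ^ toℕ i ∙ x ∙ C ^ toℕ j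
  doubleCoset⁻ {x} y∈ with ∈-cartesianProductWith⁻ (λ i j → C ^ toℕ i ∙ x ∙ C ^ toℕ j) (allFin 7) (allFin 7) y∈
  ... | i , j , _ , _ , eq = i , j , eq

  C^-cancelʳ : ∀ i x → x ∙ C ^ i ∙ C ^ (6 * i) ≡ x
  C^-cancelʳ i x = begin
    x ∙ C ^ i ∙ C ^ (6 * i)     ≡⟨ assoc _ _ _ ⟩
    x ∙ (C ^ i ∙ C ^ (6 * i))   ≡⟨ cong (x ∙_) (sym (^-+ C i (6 * i))) ⟩
    x ∙ C ^ (7 * i)             ≡⟨ cong (x ∙_) (trans (cong (C ^_) (*-comm 7 i)) (^-multiple i C⁷)) ⟩
    x ∙ ε                       ≡⟨ identityʳ x ⟩
    x                           ∎

  solve : ∀ {x z} i j k l → C ^ i ∙ x ∙ C ^ j ≡ C ^ k ∙ z ∙ C ^ l → C ^ (6 * k + i) ∙ x ∙ C ^ (j + 6 * l) ≡ z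
  solve {x} {z} i j k l eq = begin
    C ^ (6 * k + i) ∙ x ∙ C ^ (j + 6 * l)                 ≡⟨ cong₂ (λ y w → y ∙ x ∙ w) (^-+ C (6 * k) i) (^-+ C j (6 * l)) ⟩
    C ^ (6 * k) ∙ C ^ i ∙ x ∙ (C ^ j ∙ C ^ (6 * l))       ≡⟨ sym (assoc _ _ _) ⟩
    C ^ (6 * k) ∙ C ^ i ∙ x ∙ C ^ j ∙ C ^ (6 * l)         ≡⟨ cong (λ y → y ∙ C ^ j ∙ C ^ (6 * l)) (assoc _ _ _) ⟩
    C ^ (6 * k) ∙ (C ^ i ∙ x) ∙ C ^ j ∙ C ^ (6 * l)       ≡⟨ cong (_∙ C ^ (6 * l)) (assoc _ _ _) ⟩
    C ^ (6 * k) ∙ (C ^ i ∙ x ∙ C ^ j) ∙ C ^ (6 * l)       ≡⟨ cong (λ y → C ^ (6 * k) ∙ y ∙ C ^ (6 * l)) (trans eq (assoc _ _ _)) ⟩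
    C ^ (6 * k) ∙ (C ^ k ∙ (z ∙ C ^ l)) ∙ C ^ (6 * l)     ≡⟨ cong (_∙ C ^ (6 * l)) (C^-cancel k _) ⟩
    z ∙ C ^ l ∙ C ^ (6 * l)                               ≡⟨ C^-cancelʳ l z ⟩
    z                                                     ∎

  -- A repetition among the 49 products with j ≠ l gives xCᵈ = Cᵉx with Cᵈ ≠ 1, putting x into the
  -- normaliser.
  doubleCoset-injective : ∀ {x} → ¬ N x → ∀ {i k j l : Fin 7} →
    C ^ toℕ i ∙ x ∙ C ^ toℕ j ≡ C ^ toℕ k ∙ x ∙ C ^ toℕ l → i ≡ k × j ≡ l
  doubleCoset-injective {x} ¬Nx {i} {k} {j} {l} eq with j ≟ l
  ... | yes refl = C^-injective (∙-cancelʳ x _ _ (∙-cancelʳ (C ^ toℕ j) _ _ eq)) , refl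
  ... | no  j≢l  = contradiction (power-intertwine⇒N d e Cᵈ≢ε xCᵈ≡Cᵉx) ¬Nx
    where
    -- Modulo 7 these are d = j - l and e = k - i.
    d = toℕ j + 6 * toℕ l
    e = 6 * (6 * toℕ k + toℕ i)
    xCᵈ≡Cᵉx : x ∙ C ^ d ≡ C ^ e ∙ x
    xCᵈ≡Cᵉx = begin
      x ∙ C ^ d                                       ≡⟨ sym (C^-cancel (6 * toℕ k + toℕ i) _) ⟩
      C ^ e ∙ (C ^ (6 * toℕ k + toℕ i) ∙ (x ∙ C ^ d)) ≡⟨ cong (C ^ e ∙_) (trans (sym (assoc _ _ _)) (solve (toℕ i) (toℕ j) (toℕ k) (toℕ l) eq)) ⟩
      C ^ e ∙ x                                       ∎
    Cᵈ≢ε : C ^ d ≢ ε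
    Cᵈ≢ε Cᵈ≡ε = j≢l (C^-injective (begin
      C ^ toℕ j                               ≡⟨ sym (C^-cancelʳ (toℕ l) _) ⟩
      C ^ toℕ j ∙ C ^ toℕ l ∙ C ^ (6 * toℕ l) ≡⟨ cong (_∙ C ^ (6 * toℕ l)) (^-comm C (toℕ j) (toℕ l)) ⟩
      C ^ toℕ l ∙ C ^ toℕ j ∙ C ^ (6 * toℕ l) ≡⟨ assoc _ _ _ ⟩
      C ^ toℕ l ∙ (C ^ toℕ j ∙ C ^ (6 * toℕ l)) ≡⟨ cong (C ^ toℕ l ∙_) (trans (sym (^-+ C (toℕ j) (6 * toℕ l))) Cᵈ≡ε) ⟩
      C ^ toℕ l ∙ ε                           ≡⟨ identityʳ _ ⟩
      C ^ toℕ l                               ∎))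

  49∣outside : 49 ∣ length (filter (∁? N?) (allFin n))
  49∣outside = blocks⇒∣length _≟_ 49 doubleCoset outside (Unique.filter⁺ (∁? N?) (Unique.allFin⁺ n)) record
    { size   = λ _ → refl
    ; unique = λ x∈ → Unique.cartesianProductWith⁺ _ (doubleCoset-injective (¬N x∈)) (Unique.allFin⁺ 7) (Unique.allFin⁺ 7)
    ; self   = λ {x} _ → subst (_∈ doubleCoset x) (trans (identityʳ _) (identityˡ x)) (doubleCoset⁺ x 0 0)
    ; inside = λ {x} x∈ y∈ → ∈-filter⁺ (∁? N?) (∈-allFin _) (stays (¬N x∈) (doubleCoset⁻ y∈))
    ; meet   = λ _ _ y∈x y∈z → meets (doubleCoset⁻ y∈x) (doubleCoset⁻ y∈z)
    }
    where
    outside = filter (∁? N?) (allFin n)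
    ¬N : ∀ {x} → x ∈ outside → ¬ N x
    ¬N x∈ = proj₂ (∈-filter⁻ (∁? N?) {xs = allFin n} x∈)
    stays : ∀ {x y} → ¬ N x → (∃₂ λ (i j : Fin 7) → y ≡ C ^ toℕ i ∙ x ∙ C ^ toℕ j) → ¬ N y
    stays ¬Nx (i , j , refl) (k , p) =
      ¬Nx (k , conj-cancelˡ (toℕ k) (C^-comm (toℕ i)) (conj-cancelʳ (toℕ k) (C^-comm (toℕ j)) p))
    meets : ∀ {x y z} → (∃₂ λ (i j : Fin 7) → y ≡ C ^ toℕ i ∙ x ∙ C ^ toℕ j) →
      (∃₂ λ (k l : Fin 7) → y ≡ C ^ toℕ k ∙ z ∙ C ^ toℕ l) → z ∈ doubleCoset x
    meets {x} (i , j , p) (k , l , q) = subst (_∈ doubleCoset x)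
      (solve (toℕ i) (toℕ j) (toℕ k) (toℕ l) (trans (sym p) q)) (doubleCoset⁺ x (6 * toℕ k + toℕ i) (toℕ j + 6 * toℕ l))

  normaliser-count : ∃ λ q → length normaliser + q * 49 ≡ n
  normaliser-count = quotient 49∣outside , trans (cong (length normaliser +_) (sym (_∣_.equality 49∣outside)))
    (trans (length-filter-∁ N? (allFin n)) (length-tabulate {n = n} (λ i → i)))

  unique⇒≤normaliser : ∀ {xs} → Unique xs → All N xs → length xs ≤ length normaliser
  unique⇒≤normaliser xs! Nxs = unique-⊆⇒length≤ xs! λ x∈ → ∈-filter⁺ N? (∈-allFin _) (All.lookup Nxs x∈)

  -- Left cosets of the normaliser

  coset : Word → List (Fin n)
  coset u = map (⟦ u ⟧ ∙_) normaliser

  -- If uy = vz with y and z in the normaliser, then x = u⁻¹v satisfies xz = y. Comparing the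
  -- actions of z and y on C gives xCᵏ = Cʲx with Cᵏ ≠ 1.
  coset-disjoint : ∀ u v → ¬ N ⟦ invert u ++ v ⟧ → Disjoint (coset u) (coset v)
  coset-disjoint u v ¬N (x∈u , x∈v) with ∈-map⁻ (⟦ u ⟧ ∙_) x∈u | ∈-map⁻ (⟦ v ⟧ ∙_) x∈v
  ... | y , y∈ , refl | z , z∈ , uy≡vz
    with proj₂ (∈-filter⁻ N? {xs = allFin n} y∈) | proj₂ (∈-filter⁻ N? {xs = allFin n} z∈)
  ...   | j , q | k , r = ¬N (power-intertwine⇒N (toℕ k) (toℕ j) Cᵏ≢ε (∙-cancelʳ z _ _ (begin
      x ∙ C ^ toℕ k ∙ z     ≡⟨ assoc _ _ _ ⟩
      x ∙ (C ^ toℕ k ∙ z)   ≡⟨ cong (x ∙_) (sym r) ⟩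
      x ∙ (z ∙ C)           ≡⟨ sym (assoc _ _ _) ⟩
      x ∙ z ∙ C             ≡⟨ cong (_∙ C) xz≡y ⟩
      y ∙ C                 ≡⟨ q ⟩
      C ^ toℕ j ∙ y         ≡⟨ cong (C ^ toℕ j ∙_) (sym xz≡y) ⟩
      C ^ toℕ j ∙ (x ∙ z)   ≡⟨ sym (assoc _ _ _) ⟩
      C ^ toℕ j ∙ x ∙ z     ∎)))
    where
    x = ⟦ invert u ++ v ⟧
    xz≡y : x ∙ z ≡ y
    xz≡y = begin
      x ∙ z                         ≡⟨ cong (_∙ z) (trans (⟦⟧-++ (invert u) v) (cong (_∙ ⟦ v ⟧) (⟦invert⟧ u))) ⟩
      ⟦ u ⟧ ⁻¹ ∙ ⟦ v ⟧ ∙ z          ≡⟨ assoc _ _ _ ⟩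
      ⟦ u ⟧ ⁻¹ ∙ (⟦ v ⟧ ∙ z)        ≡⟨ cong (⟦ u ⟧ ⁻¹ ∙_) (sym uy≡vz) ⟩
      ⟦ u ⟧ ⁻¹ ∙ (⟦ u ⟧ ∙ y)        ≡⟨ inverse-cancelˡ _ y ⟩
      y                             ∎
    Cᵏ≢ε : C ^ toℕ k ≢ ε
    Cᵏ≢ε Cᵏ≡ε = conj-nonzero (trans r (cong (_∙ z) Cᵏ≡ε))

  cosets-disjoint : ∀ us → All (¬_ ∘ N ∘ ⟦_⟧) (differences us) → AllPairs Disjoint (map coset us)
  cosets-disjoint []       _   = []
  cosets-disjoint (u ∷ us) ¬Ns =
    All.map⁺ (All.map (λ {v} → coset-disjoint u v) (All.map⁻ (All.++⁻ˡ (map (λ v → invert u ++ v) us) ¬Ns)))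
    ∷ cosets-disjoint us (All.++⁻ʳ (map (λ v → invert u ++ v) us) ¬Ns)

  length-cosets : ∀ us → length (concat (map coset us)) ≡ length us * length normaliser
  length-cosets []       = refl
  length-cosets (u ∷ us) = trans (length-++ (coset u)) (cong₂ _+_ (length-map _ normaliser) (length-cosets us))

  Coincidence : List Word → Set
  Coincidence us = ∃₂ λ u k → u ∈ doubleCosets us × k < 7 × k ≢ 0 × Conj k ⟦ u ⟧

  -- Pigeonhole: if no quotient lay in the normaliser, the left cosets would be disjoint and
  -- together exceed the group.
  coincidence : ∀ us → n < length us * length normaliser → Coincidence us
  coincidence us n< with Any.any? (N? ∘ ⟦_⟧) (differences us)
  ... | yes any with find any
  ...   | w , w∈ , k , p = doubleCosetForm w , toℕ k ,
            ∈-doubleCosets us w∈ , toℕ<n k ,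
            (λ k≡0 → conj-nonzero (subst (λ k → Conj k ⟦ w ⟧) k≡0 p)) , conj-doubleCosetForm (toℕ k) w p
  coincidence us n< | no ¬any = contradiction n< (≤⇒≯ (subst₂ _≤_ (length-cosets us) (length-tabulate {n = n} (λ i → i))
    (unique-⊆⇒length≤ {ys = allFin n}
      (Unique.concat⁺ (All.map⁺ (All.tabulate λ _ → Unique.map⁺ (∙-cancelˡ _ _ _) (Unique.filter⁺ N? (Unique.allFin⁺ n))))
        (cosets-disjoint us (All.¬Any⇒All¬ (differences us) ¬any)))
      λ _ → ∈-allFin _)))

-- Coset enumerations

rotations : Word → List Word
rotations v = map (λ i → (c ∷ []) ^ʷ i ++ v) (upTo 7)

-- The left cosets of ⟨C⟩ are the vertices of the tessellation {3,7}; these words reach vertices close to the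
-- centre of the rotation C.  The choice for 37 was optimised by a search, and avoids quotients such as PSL(2,13).
vertices₈ vertices₉ vertices₃₇ : List Word
vertices₈  = [] ∷ rotations (a ∷ [])
vertices₉  = (a ∷ c ∷ c ∷ a ∷ []) ∷ vertices₈
vertices₃₇ =
  (a ∷ c ∷ c ∷ a ∷ c̄ ∷ c̄ ∷ c̄ ∷ a ∷ []) ∷ [] ∷ concatMap rotations
    ( (a ∷ [])
    ∷ (a ∷ c ∷ c ∷ a ∷ [])
    ∷ (a ∷ c ∷ c ∷ c ∷ a ∷ [])
    ∷ (a ∷ c̄ ∷ c̄ ∷ c̄ ∷ a ∷ [])
    ∷ (a ∷ c ∷ c ∷ a ∷ c̄ ∷ c̄ ∷ a ∷ [])
    ∷ [])

nonzeroResidues : List ℕ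
nonzeroResidues = 1 ∷ 2 ∷ 3 ∷ 4 ∷ 5 ∷ 6 ∷ []

-- ABAB⁻¹, with B = AC⁻¹.
commutator : Word
commutator = c̄ ∷ a ∷ c ∷ a ∷ []

-- Conjugates C to C⁻¹ when S² = 1.
inverter : Word
inverter = a ∷ c ∷ c ∷ c ∷ a ∷ c ∷ c ∷ c ∷ a ∷ c ∷ c ∷ a ∷ c̄ ∷ c̄ ∷ a ∷ []

M^_ : ℕ → Word
M^ k = mirrorWord ^ʷ k

collapsed∨M³ collapsed∨M³∨M² : Table → Bool
collapsed∨M³    t = collapsed t ∨ fixes (M^ 3) t
collapsed∨M³∨M² t = collapsed∨M³ t ∨ fixes (M^ 2) t

opaque
  unfolding cosetTable doubleCosets

  M-collapses : collapsed (cosetTable ((M^ 1) ∷ [])) ≡ true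
  M-collapses = refl

  M²-commutator⁹ : fixes (commutator ^ʷ 9) (cosetTable ((M^ 2) ∷ [])) ≡ true
  M²-commutator⁹ = refl

  M²-commutator³-collapses : collapsed (cosetTable ((M^ 2) ∷ (commutator ^ʷ 3) ∷ [])) ≡ true
  M²-commutator³-collapses = refl

  M²-inverter : fixes (conjRelator 6 inverter) (cosetTable ((M^ 2) ∷ [])) ≡ true
  M²-inverter = refl

  M²-72-cosets : hasCosets 72 (cosetTable ((M^ 2) ∷ [])) ≡ true
  M²-72-cosets = refl

  M³-24-cosets : hasCosets 24 (cosetTable ((M^ 3) ∷ [])) ≡ true
  M³-24-cosets = refl

  vertices₈-check : checkConj collapsed nonzeroResidues (doubleCosets vertices₈) ≡ true
  vertices₈-check = refl

  vertices₉-check : checkConj collapsed∨M³ nonzeroResidues (doubleCosets vertices₉) ≡ true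
  vertices₉-check = refl

  vertices₃₇-check : checkConj collapsed∨M³∨M² (1 ∷ 6 ∷ []) (doubleCosets vertices₃₇) ≡ true
  vertices₃₇-check = refl

∨-true : ∀ {x y} → x ∨ y ≡ true → x ≡ true ⊎ y ≡ true
∨-true {true}  _  = inj₁ refl
∨-true {false} eq = inj₂ eq

-- With m at least `l`, more than `Q` blocks of 49 would overshoot n; hence q ≤ Q.
remainder-bound : ∀ {m n} l Q → (∃ λ q → m + q * 49 ≡ n) → l ≤ m → n < l + suc Q * 49 → n ≤ m + Q * 49
remainder-bound {m} l Q (q , refl) l≤m n< = +-monoʳ-≤ m (*-monoˡ-≤ 49 q≤Q)
  where
  q≤Q : q ≤ Q
  q≤Q with s≤s le ← *-cancelʳ-< 49 q (suc Q) (+-cancelˡ-< l _ _ (≤-<-trans (+-monoˡ-≤ (q * 49) l≤m) n<)) = le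

nonzeroResidue : ∀ {k} → k < 7 → k ≢ 0 → k ∈ nonzeroResidues
nonzeroResidue {0} _ k≢0 = contradiction refl k≢0
nonzeroResidue {1} _ _ = here refl
nonzeroResidue {2} _ _ = there (here refl)
nonzeroResidue {3} _ _ = there (there (here refl))
nonzeroResidue {4} _ _ = there (there (there (here refl)))
nonzeroResidue {5} _ _ = there (there (there (there (here refl))))
nonzeroResidue {6} _ _ = there (there (there (there (there (here refl)))))
nonzeroResidue {suc (suc (suc (suc (suc (suc (suc _))))))} (s≤s (s≤s (s≤s (s≤s (s≤s (s≤s (s≤s ()))))))) _

reaches-9-3 : Reaches 9 3
reaches-9-3 = from-yes (reaches? 9 3)

-- Group orders and link indices

module Classification {n : ℕ} (G : FinGroup n) (h : HurwitzTriple G) (nontrivial : 1 < n) where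
  open Normaliser G h nontrivial

  M : Fin n
  M = mirror G h

  #N : ℕ
  #N = length normaliser

  M^-trivial : ∀ k → M ^ k ≡ ε → Trivial ((M^ k) ∷ [])
  M^-trivial k eq = trans (⟦mirrorWord^⟧ k) eq ∷ []

  M^-fixed : ∀ k rs → Trivial rs → fixes (M^ k) (cosetTable rs) ≡ true → M ^ k ≡ ε
  M^-fixed k rs ps eq = trans (sym (⟦mirrorWord^⟧ k)) (fixes⇒≡ε rs (M^ k) ps eq)

  M≢ε : M ^ 1 ≢ ε
  M≢ε eq = refute ((M^ 1) ∷ []) (M^-trivial 1 eq) M-collapses

  hasCosets-bound : ∀ m rs → Trivial rs → hasCosets m (cosetTable rs) ≡ true → n ≤ 7 * m
  hasCosets-bound m rs ps eq = subst (λ l → n ≤ 7 * l)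
    (≡ᵇ⇒≡ (length ks) m (Equivalence.from T-≡ (∧-conicalʳ (closed (cosetTable rs) ks) _ eq)))
    (index-bound rs ks ps (∧-conicalˡ _ _ eq))
    where ks = cosets (cosetTable rs)

  M²⇒n≤504 : M ^ 2 ≡ ε → n ≤ 504
  M²⇒n≤504 eq = hasCosets-bound 72 ((M^ 2) ∷ []) (M^-trivial 2 eq) M²-72-cosets

  M³⇒n≤168 : M ^ 3 ≡ ε → n ≤ 168
  M³⇒n≤168 eq = hasCosets-bound 24 ((M^ 3) ∷ []) (M^-trivial 3 eq) M³-24-cosets

  -- The ninth power of the commutator is trivial, and a trivial cube would collapse the group, so
  -- its order is exactly 9.
  M²⇒9∣n : M ^ 2 ≡ ε → 9 ∣ n
  M²⇒9∣n M² = order∣n {x = ⟦ commutator ⟧} {m = 9} {r = 3}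
    (trans (sym (⟦⟧-^ʷ commutator 9)) (fixes⇒≡ε ((M^ 2) ∷ []) (commutator ^ʷ 9) (M^-trivial 2 M²) M²-commutator⁹))
    (λ w³ → refute ((M^ 2) ∷ (commutator ^ʷ 3) ∷ [])
      (trans (⟦mirrorWord^⟧ 2) M² ∷ trans (⟦⟧-^ʷ commutator 3) w³ ∷ []) M²-commutator³-collapses)
    reaches-9-3

  vertices₈-distinct : ¬ (n < 8 * #N)
  vertices₈-distinct n< = settle (coincidence vertices₈ n<)
    where
    settle : ¬ Coincidence vertices₈
    settle (u , k , u∈ , k<7 , k≢0 , p) =
      checkConj-sound collapsed nonzeroResidues (doubleCosets vertices₈) refute vertices₈-check
        u∈ (nonzeroResidue k<7 k≢0) p

  collapsed∨M³-sound : ∀ rs → Trivial rs → collapsed∨M³ (cosetTable rs) ≡ true → M ^ 3 ≡ ε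
  collapsed∨M³-sound rs ps eq with ∨-true eq
  ... | inj₁ collapse = ⊥-elim (refute rs ps collapse)
  ... | inj₂ fixed    = M^-fixed 3 rs ps fixed

  vertices₉-coincide⇒M³ : n < 9 * #N → M ^ 3 ≡ ε
  vertices₉-coincide⇒M³ n< = settle (coincidence vertices₉ n<)
    where
    settle : Coincidence vertices₉ → M ^ 3 ≡ ε
    settle (u , k , u∈ , k<7 , k≢0 , p) =
      checkConj-sound collapsed∨M³ nonzeroResidues (doubleCosets vertices₉) collapsed∨M³-sound vertices₉-check
        u∈ (nonzeroResidue k<7 k≢0) p

  collapsed∨M³∨M²-sound : ∀ rs → Trivial rs → collapsed∨M³∨M² (cosetTable rs) ≡ true → M ^ 3 ≡ ε ⊎ M ^ 2 ≡ ε
  collapsed∨M³∨M²-sound rs ps eq with ∨-true {collapsed∨M³ (cosetTable rs)} eq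
  ... | inj₁ eq′   = inj₁ (collapsed∨M³-sound rs ps eq′)
  ... | inj₂ fixed = inj₂ (M^-fixed 2 rs ps fixed)

  conj-disjoint : ∀ {i j xs ys} → All (Conj i) xs → All (Conj j) ys → i mod 7 ≢ j mod 7 → Disjoint xs ys
  conj-disjoint {i} {j} ps qs i≢j (x∈xs , x∈ys) =
    i≢j (conj-unique {i} {j} (All.lookup ps x∈xs) (All.lookup qs x∈ys))

  conj⇒All-N : ∀ k {xs} → All (Conj k) xs → All N xs
  conj⇒All-N k = All.map (conj⇒N k)

  C-powers : Fin n → List (Fin n)
  C-powers y = tabulate {n = 7} λ i → y ∙ C ^ toℕ i

  C-powers-unique : ∀ y → Unique (C-powers y)
  C-powers-unique y = Unique.tabulate⁺ λ eq → C^-injective (∙-cancelˡ y _ _ eq)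

  conj-C-powers : ∀ k {y} → Conj k y → All (Conj (1 * k)) (C-powers y)
  conj-C-powers k p = All.tabulate⁺ λ i → conj-∙ k 1 p (conj-C^ (toℕ i))

  conj-ε : Conj 1 ε
  conj-ε = conj-C^ 0

  -- The seven powers of C act on C with exponent 1, so `y` is an eighth element.
  conj≢1⇒8≤#N : ∀ k {y} → Conj k y → 1 mod 7 ≢ k mod 7 → 8 ≤ #N
  conj≢1⇒8≤#N k {y} p 1≢k = unique⇒≤normaliser
    (Unique.++⁺ (C-powers-unique ε) ([] ∷ []) (conj-disjoint {1} {k} (conj-C-powers 1 conj-ε) (p ∷ []) 1≢k))
    (All.++⁺ (conj⇒All-N 1 (conj-C-powers 1 conj-ε)) (conj⇒N k p ∷ []))

  -- The cosets ⟨C⟩ and y⟨C⟩ and the element y² act on C with the distinct exponents 1, k and k²,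
  -- giving 7 + 7 + 1 elements.
  conj²≢1⇒15≤#N : ∀ k {y} → Conj k y → 1 mod 7 ≢ (1 * k) mod 7 → 1 mod 7 ≢ (k * k) mod 7 →
    (1 * k) mod 7 ≢ (k * k) mod 7 → 15 ≤ #N
  conj²≢1⇒15≤#N k {y} p 1≢k 1≢k² k≢k² = unique⇒≤normaliser
    (Unique.++⁺ (C-powers-unique ε)
      (Unique.++⁺ (C-powers-unique y) ([] ∷ []) (conj-disjoint {1 * k} {k * k} ps (q ∷ []) k≢k²))
      λ { (x∈ , x∈′) → elsewhere x∈ (∈-++⁻ (C-powers y) x∈′) })
    (All.++⁺ (conj⇒All-N 1 (conj-C-powers 1 conj-ε)) (All.++⁺ (conj⇒All-N (1 * k) ps) (conj⇒N (k * k) q ∷ [])))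
    where
    ps : All (Conj (1 * k)) (C-powers y)
    ps = conj-C-powers k p
    q : Conj (k * k) (y ∙ y)
    q = conj-∙ k k p p
    elsewhere : ∀ {x} → x ∈ C-powers ε → x ∈ C-powers y ⊎ x ∈ (y ∙ y) ∷ [] → ⊥
    elsewhere x∈ (inj₁ x∈y)  = conj-disjoint {1} {1 * k} (conj-C-powers 1 conj-ε) ps 1≢k (x∈ , x∈y)
    elsewhere x∈ (inj₂ x∈y²) = conj-disjoint {1} {k * k} (conj-C-powers 1 conj-ε) (q ∷ []) 1≢k² (x∈ , x∈y²)

  -- For k = 2, 3, 4, 5 the residues 1, k and k² are distinct modulo 7.
  conj-±1 : ¬ (15 ≤ #N) → ∀ {k y} → k ∈ nonzeroResidues → Conj k y → k ∈ 1 ∷ 6 ∷ []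
  conj-±1 few (here refl) p = here refl
  conj-±1 few (there (here refl)) p = contradiction (conj²≢1⇒15≤#N 2 p (λ ()) (λ ()) (λ ())) few
  conj-±1 few (there (there (here refl))) p = contradiction (conj²≢1⇒15≤#N 3 p (λ ()) (λ ()) (λ ())) few
  conj-±1 few (there (there (there (here refl)))) p = contradiction (conj²≢1⇒15≤#N 4 p (λ ()) (λ ()) (λ ())) few
  conj-±1 few (there (there (there (there (here refl))))) p = contradiction (conj²≢1⇒15≤#N 5 p (λ ()) (λ ()) (λ ())) few
  conj-±1 few (there (there (there (there (there (here refl)))))) p = there (here refl)

  -- Here `N` is the order as a numeral, so that the inequalities are settled by evaluation; `Q`
  -- bounds the number of double cosets outside the normaliser.
  #N-lowerBound : ∀ l Q b {N} → n ≡ N → l ≤ #N → N < l + suc Q * 49 → b + Q * 49 ≡ N → b ≤ #N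
  #N-lowerBound l Q b refl l≤ n< eq = +-cancelʳ-≤ (Q * 49) b #N
    (≤-trans (≤-reflexive eq) (remainder-bound l Q normaliser-count l≤ n<))

  exceeds : ∀ m {b} {N} → n ≡ N → b ≤ #N → N < m * b → n < m * #N
  exceeds m refl b≤ n< = ≤-trans n< (*-monoʳ-≤ m b≤)

  n≢84 : n ≢ 84
  n≢84 eq = vertices₈-distinct (exceeds 8 eq
    (#N-lowerBound 0 1 35 eq z≤n (from-yes (84 <? 98)) refl) (from-yes (84 <? 280)))

  n≡168⇒M³ : n ≡ 168 → M ^ 3 ≡ ε
  n≡168⇒M³ eq = vertices₉-coincide⇒M³ (exceeds 9 eq
    (#N-lowerBound 0 3 21 eq z≤n (from-yes (168 <? 196)) refl) (from-yes (168 <? 189)))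

  M²⇒n≢252 : M ^ 2 ≡ ε → n ≢ 252
  M²⇒n≢252 M² eq = vertices₈-distinct (exceeds 8 eq
    -- The prior bound 8 rules out a normaliser of order 7, since 252 = 7 + 5·49; the next possible
    -- order is 56.
    (#N-lowerBound 8 4 56 eq (conj≢1⇒8≤#N 6 inverts (λ ())) (from-yes (252 <? 253)) refl) (from-yes (252 <? 448)))
    where
    inverts : Conj 6 ⟦ inverter ⟧
    inverts = conjRelator⇒Conj 6 inverter
      (fixes⇒≡ε ((M^ 2) ∷ []) (conjRelator 6 inverter) (M^-trivial 2 M²) M²-inverter)

  504≰168 : n ≡ 504 → ¬ (n ≤ 168)
  504≰168 eq = subst (λ m → ¬ (m ≤ 168)) (sym eq) (from-no (504 ≤? 168))

  vertices₃₇-coincide : ¬ (15 ≤ #N) → n < 37 * #N → M ^ 3 ≡ ε ⊎ M ^ 2 ≡ ε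
  vertices₃₇-coincide few n< = settle (coincidence vertices₃₇ n<)
    where
    settle : Coincidence vertices₃₇ → M ^ 3 ≡ ε ⊎ M ^ 2 ≡ ε
    settle (u , k , u∈ , k<7 , k≢0 , p) =
      checkConj-sound collapsed∨M³∨M² (1 ∷ 6 ∷ []) (doubleCosets vertices₃₇) collapsed∨M³∨M²-sound vertices₃₇-check
        u∈ (conj-±1 few (nonzeroResidue k<7 k≢0) p) p

  n≡504⇒M² : n ≡ 504 → M ^ 2 ≡ ε
  n≡504⇒M² eq with 15 ≤? #N
  ... | yes 15≤ = contradiction (M³⇒n≤168 (vertices₉-coincide⇒M³ (exceeds 9 eq
          -- Since 504 = 14 + 10·49, a normaliser with at least 15 elements has at least 63.
          (#N-lowerBound 15 9 63 eq 15≤ (from-yes (504 <? 505)) refl) (from-yes (504 <? 567))))) (504≰168 eq)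
  ... | no few = [ (λ M³ → contradiction (M³⇒n≤168 M³) (504≰168 eq)) , (λ M² → M²) ]′
          -- As 36·14 = 504, a list of 37 words is the shortest that exceeds the order.
          (vertices₃₇-coincide few (exceeds 37 eq
            (#N-lowerBound 0 10 14 eq z≤n (from-yes (504 <? 539)) refl) (from-yes (504 <? 518))))

  -- The genus is g + 2. Of the orders 84(g + 1) up to 504, only 252 and 504 are divisible by 9.
  M²⇒6 : ∀ g → n ≡ 84 * suc g → M ^ 2 ≡ ε → g ≡ 5
  M²⇒6 g eq M² = cases g eq (subst (9 ∣_) eq (M²⇒9∣n M²)) (*-cancelˡ-≤ 84 (subst (_≤ 504) eq (M²⇒n≤504 M²)))
    where
    cases : ∀ g → n ≡ 84 * suc g → 9 ∣ 84 * suc g → suc g ≤ 6 → g ≡ 5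
    cases 0 _  9∣ _ = contradiction 9∣ (from-no (9 ∣? 84))
    cases 1 _  9∣ _ = contradiction 9∣ (from-no (9 ∣? 168))
    cases 2 eq _  _ = contradiction eq (M²⇒n≢252 M²)
    cases 3 _  9∣ _ = contradiction 9∣ (from-no (9 ∣? 336))
    cases 4 _  9∣ _ = contradiction 9∣ (from-no (9 ∣? 420))
    cases 5 _  _  _ = refl
    cases (suc (suc (suc (suc (suc (suc _)))))) _ _ (s≤s (s≤s (s≤s (s≤s (s≤s (s≤s ()))))))

  M³⇒2 : ∀ g → n ≡ 84 * suc g → M ^ 3 ≡ ε → g ≡ 1
  M³⇒2 g eq M³ = cases g eq (*-cancelˡ-≤ 84 (subst (_≤ 168) eq (M³⇒n≤168 M³)))
    where
    cases : ∀ g → n ≡ 84 * suc g → suc g ≤ 2 → g ≡ 1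
    cases 0 eq _ = contradiction eq n≢84
    cases 1 _  _ = refl
    cases (suc (suc _)) _ (s≤s (s≤s ()))

theorem6p5 : ∀ {n : ℕ} (G : FinGroup n) (h : HurwitzTriple G) (g : ℕ) →
    HasHurwitzGenus G g →
    (¬ LinkIndex G h 1)
    × (LinkIndex G h 2 ⇔ g ≡ 7)
    × (LinkIndex G h 3 ⇔ g ≡ 3)
theorem6p5 G h (suc (suc g)) (s≤s (s≤s z≤n) , n≡84[g+1]) =
    (λ index₁ → M≢ε (pow≡ε index₁))
  , mk⇔ (λ index₂ → cong (λ g → suc (suc g)) (M²⇒6 g n≡84[g+1] (pow≡ε index₂)))
        (λ { refl → record
          { positive = s≤s z≤n
          ; pow≡ε    = n≡504⇒M² n≡84[g+1]
          ; minimal  = λ { 1 _ _ → M≢ε ; (suc (suc _)) _ (s≤s (s≤s ())) } } })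
  , mk⇔ (λ index₃ → cong (λ g → suc (suc g)) (M³⇒2 g n≡84[g+1] (pow≡ε index₃)))
        (λ { refl → record
          { positive = s≤s z≤n
          ; pow≡ε    = n≡168⇒M³ n≡84[g+1]
          ; minimal  = λ
            { 1 _ _ → M≢ε
            -- S² = 1 would force order 504, that is genus 7, instead of 168.
            ; 2 _ _ M² → contradiction (M²⇒6 1 n≡84[g+1] M²) (λ ())
            ; (suc (suc (suc _))) _ (s≤s (s≤s (s≤s ()))) } } })
  where
  open HasOrder
  open Classification G h (subst (1 <_) (sym n≡84[g+1]) (≤-trans (from-yes (2 ≤? 84)) (m≤m*n 84 (suc g))))
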